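{- Let $G$ be a $12$-representable (finite, connected) square grid graph. Then there exist a labeling of $G$ and a word $w$ $12$-representing the labeled graph such that in $w$: the label of each corner node occurs exactly twice (and for no good labeling can the label of a corner node appear only once in such a word); between the two copies of the label of a corner node there are exactly two other letters; and the label of every non-corner node occurs exactly once.
   Context: The grid graph is the infinite graph on $\mathbb{Z}^2$ with vertices adjacent iff at Euclidean distance $1$. A square of an induced subgraph $H$ of it is a set of four vertices of $H$ of the form $\{(x,y),(x+1,y),(x,y+1),(x+1,y+1)\}$. A square grid graph is a finite connected induced subgraph of the grid graph in which every vertex and edge lies in some square of it. A labeled graph has distinct positive integers as vertices. A word $w$ $12$-represents a labeled graph $G=(V,E)$ if the set of letters of $w$ is $V$ and for all distinct $x,y\in V$: $xy\notin E$ iff some occurrence of $\min(x,y)$ precedes some occurrence of $\max(x,y)$ in $w$. An unlabeled graph is $12$-representable if some labeling of it is $12$-representable. A labeling is good if it has none of: (i) labels $p<q<r$ inducing exactly the edges $pq,qr$; (ii) labels $p<q<r<s$ inducing exactly the edges $pr,qs$; (iii) labels $p<q<r<s$ inducing exactly the edges $ps,qr$. A square $S$ is an end-square if it has an edge $ab$ (of the $4$-cycle $S$) such that neither $a$ nor $b$ is a vertex of a square other than $S$. A corner node is a node that belongs to exactly one square, where this square is not an end-square and shares an edge with each of two other squares. -}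

module Defs where

open import Data.Nat as ℕ using (ℕ; _<_; _⊓_; _⊔_)
open import Data.Integer as ℤ using (ℤ; +_)
open import Data.Product using (_×_; _,_; Σ; ∃; ∃-syntax)
open import Data.Sum using (_⊎_)
open import Data.List using (List; []; _∷_; _++_; length; filter)
open import Data.List.Membership.Propositional using (_∈_)
open import Relation.Nullary using (¬_)
open import Relation.Binary.PropositionalEquality using (_≡_; _≢_)

Point : Set
Point = ℤ × ℤ

Adj : Point → Point → Set
Adj (x , y) (x' , y') =
  (x ≡ x' × (y' ≡ y ℤ.+ + 1 ⊎ y ≡ y' ℤ.+ + 1)) ⊎
  (y ≡ y' × (x' ≡ x ℤ.+ + 1 ⊎ x ≡ x' ℤ.+ + 1))

-- A finite induced subgraph of the grid graph is given by its finite
-- vertex set V (a list of points; membership is what matters); edges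
-- are all grid edges between vertices of V.

data Path (V : List Point) : Point → Point → Set where
  here : ∀ {u} → u ∈ V → Path V u u
  step : ∀ {u w v} → u ∈ V → Adj u w → Path V w v → Path V u v

Connected : List Point → Set
Connected V = ∀ u v → u ∈ V → v ∈ V → Path V u v

SqPt : Point → Point → Set
SqPt (x , y) p =
  p ≡ (x , y) ⊎ p ≡ (x ℤ.+ + 1 , y) ⊎ p ≡ (x , y ℤ.+ + 1) ⊎ p ≡ (x ℤ.+ + 1 , y ℤ.+ + 1)

Square : List Point → Point → Set
Square V (x , y) =
  (x , y) ∈ V × (x ℤ.+ + 1 , y) ∈ V × (x , y ℤ.+ + 1) ∈ V × (x ℤ.+ + 1 , y ℤ.+ + 1) ∈ V

SquareGridGraph : List Point → Set
SquareGridGraph V =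
  Connected V ×
  (∀ v → v ∈ V → ∃[ c ] (Square V c × SqPt c v)) ×
  (∀ u v → u ∈ V → v ∈ V → Adj u v → ∃[ c ] (Square V c × SqPt c u × SqPt c v))

OnlyIn : List Point → Point → Point → Set
OnlyIn V c a = ∀ c' → Square V c' → SqPt c' a → c' ≡ c

EndSquare : List Point → Point → Set
EndSquare V c =
  ∃[ a ] ∃[ b ] (SqPt c a × SqPt c b × Adj a b × OnlyIn V c a × OnlyIn V c b)

ShareEdge : Point → Point → Set
ShareEdge c c' = ∃[ a ] ∃[ b ] (Adj a b × SqPt c a × SqPt c b × SqPt c' a × SqPt c' b)

Corner : List Point → Point → Set
Corner V v =
  ∃[ c ] (Square V c × SqPt c v × OnlyIn V c v × ¬ EndSquare V c ×
          ∃[ c₁ ] ∃[ c₂ ] (Square V c₁ × Square V c₂ ×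
                           c₁ ≢ c × c₂ ≢ c × c₁ ≢ c₂ ×
                           ShareEdge c c₁ × ShareEdge c c₂))

Labeling : List Point → (Point → ℕ) → Set
Labeling V ℓ =
  (∀ v → v ∈ V → 0 < ℓ v) ×
  (∀ u v → u ∈ V → v ∈ V → ℓ u ≡ ℓ v → u ≡ v)

Precedes : ℕ → ℕ → List ℕ → Set
Precedes a b w = ∃[ xs ] ∃[ ys ] (w ≡ xs ++ (a ∷ ys) × b ∈ ys)

Represents12 : List Point → (Point → ℕ) → List ℕ → Set
Represents12 V ℓ w =
  (∀ a → a ∈ w → ∃[ v ] (v ∈ V × ℓ v ≡ a)) ×
  (∀ v → v ∈ V → ℓ v ∈ w) ×
  (∀ u v → u ∈ V → v ∈ V → u ≢ v →
     (¬ Adj u v → Precedes (ℓ u ⊓ ℓ v) (ℓ u ⊔ ℓ v) w) ×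
     (Precedes (ℓ u ⊓ ℓ v) (ℓ u ⊔ ℓ v) w → ¬ Adj u v))

Representable12 : List Point → Set
Representable12 V = ∃[ ℓ ] ∃[ w ] (Labeling V ℓ × Represents12 V ℓ w)

Good : List Point → (Point → ℕ) → Set
Good V ℓ =
  (∀ p q r → p ∈ V → q ∈ V → r ∈ V → ℓ p < ℓ q → ℓ q < ℓ r →
     ¬ (Adj p q × Adj q r × ¬ Adj p r)) ×
  (∀ p q r s → p ∈ V → q ∈ V → r ∈ V → s ∈ V →
     ℓ p < ℓ q → ℓ q < ℓ r → ℓ r < ℓ s →
     ¬ (Adj p r × Adj q s × ¬ Adj p q × ¬ Adj p s × ¬ Adj q r × ¬ Adj r s)) ×
  (∀ p q r s → p ∈ V → q ∈ V → r ∈ V → s ∈ V →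
     ℓ p < ℓ q → ℓ q < ℓ r → ℓ r < ℓ s →
     ¬ (Adj p s × Adj q r × ¬ Adj p q × ¬ Adj p r × ¬ Adj q s × ¬ Adj r s))

occ : ℕ → List ℕ → ℕ
occ a w = length (filter (ℕ._≟ a) w)

Gap2 : ℕ → List ℕ → Set
Gap2 a w = ∃[ xs ] ∃[ ys ] ∃[ zs ] (w ≡ xs ++ (a ∷ ys ++ (a ∷ zs)) × length ys ≡ 2)

module Submission where

-- In a 12-representing word an edge xy with x < y has all copies of y before all
-- copies of x, so in a square grid graph every vertex is "low" (smaller than all its
-- neighbours) or "high", and two edges xy, x'y' (x, x' low) with x, y' and x', y
-- non-adjacent cannot satisfy x < y' and x' < y. Let κ(c) be the larger of the two low
-- labels of a square c. By the crossing condition κ is injective, and the squares at a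
-- vertex v form an interval [α v, β v] of the κ-order; so low u and high v are adjacent
-- iff their intervals meet. Relabel by α for low and β for high vertices, and write the
-- low vertices in order of β and the high ones in order of α. This is a 12-representation
-- by a permutation, except for vertices v, m of equal class with
-- α m < α v and β v < β m: these are exactly the corners v together with their opposite
-- vertices m, and a second copy of v next to m repairs the word. For part two, the
-- crossing condition at a corner forces two other letters between two copies of v.

open import Defs
open import Data.Bool using (Bool; true; false; not; T)
import Data.Bool.Properties as Boolₚ
open import Data.Empty using (⊥; ⊥-elim)
open import Data.Integer using (ℤ; +_; _+_; 0ℤ)
import Data.Integer.Properties as ℤₚ
open import Algebra.Properties.AbelianGroup ℤₚ.+-0-abelianGroup using (∙-cancelˡ; ∙-cancelʳ)
open import Data.List using (List; []; _∷_; _++_; filter; length; map; foldr; concatMap)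
open import Data.List.Membership.Propositional using (_∈_; _∉_; find)
open import Data.List.Membership.Propositional.Properties using (∈-filter⁺; ∈-filter⁻; ∈-map⁺; ∈-map⁻; ∈-concatMap⁺; ∈-concatMap⁻; ∈-++⁺ʳ; ∈-++⁺ˡ)
open import Data.List.Properties using (filter-accept; filter-reject; filter-++; filter-none; length-++; map-++; concatMap-++; ∷-injectiveˡ; ∷-injectiveʳ)
open import Data.List.Relation.Unary.All as All using (All; []; _∷_)
import Data.List.Relation.Unary.All.Properties as Allₚ
open import Data.List.Relation.Unary.AllPairs using (AllPairs; []; _∷_)
import Data.List.Relation.Unary.AllPairs.Properties as AllPairsₚ
open import Data.List.Relation.Unary.Any as Any using (here; there)
open import Data.Nat using (ℕ; zero; suc; _<_; _≤_; _⊓_; _⊔_; _≤ᵇ_; s≤s; s<s; z<s; _≟_; _*_) renaming (_+_ to _+ℕ_)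
open import Data.Nat.ListAction using (sum)
import Data.Nat.Properties as ℕₚ
open import Data.List.Extrema ℕₚ.≤-totalOrder using (argmin; argmax; argmin-sel; argmax-sel; f[argmin]≤f[xs]; f[xs]≤f[argmax])
open import Data.Product using (_×_; _,_; proj₁; proj₂; ∃-syntax)
import Data.Product.Properties as Productₚ
open import Data.List.Membership.DecPropositional (Productₚ.≡-dec ℤₚ._≟_ ℤₚ._≟_) using (_∈?_)
open import Data.Sum using (_⊎_; inj₁; inj₂; map₁; map₂)
open import Relation.Binary using (tri<; tri≈; tri>)
open import Relation.Binary.PropositionalEquality
open import Relation.Nullary using (¬_; Dec; yes; no)
open import Relation.Nullary.Decidable using (_×-dec_; _⊎-dec_)

-- Geometry of the grid

-- Both facts about `κ` rest on one observation. The number `κ c` splits every edge of `c`: it is at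
-- least the low label and less than the high one. Two edges of an induced matching cannot be split
-- by the same number, since that would be a crossing. A vertex of one cell that lies outside
-- another always yields such a matching: an edge at it and a side of the other cell. Two cells with
-- equal `κ`, or a vertex skipping a cell between two of its own, would contradict this. The
-- exceptional pairs are located by geometry. Strict nesting forces `v` into a single cell `d`, with
-- `m` opposite, and `m` also lies in a cell `a` before `d` and a cell `b` after it. Convexity makes
-- `a`, `d`, `b` turn around `m`, so `v` is the outer corner of the bend. The gap of two comes from
-- `s`, the neighbour of `m` in `b` outside `d`. For low `v` the sorted order reads v, s, m without
-- interruption, and appending `v` to `m` gives v s m v. For high `v` the mirror image is m, s, v
-- with `s` in `a`, and the word reads v m s v. The delicate point is that `s` must not itself carry
-- a second letter, which would widen the gap.

Next : ℤ → ℤ → Set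
Next x y = y ≡ x + + 1 ⊎ x ≡ y + + 1

Within : ℤ → ℤ → Set
Within x c = x ≡ c ⊎ x ≡ c + + 1

Far : ℤ → ℤ → Set
Far x y = x ≢ y × ¬ Next x y

x≢x+1+n : ∀ {x} n → x ≢ x + + suc n
x≢x+1+n {x} n eq with ∙-cancelˡ x 0ℤ (+ suc n) (trans (ℤₚ.+-identityʳ x) eq)
... | ()

x≢x+2 : ∀ {x} → x ≢ x + + 1 + + 1
x≢x+2 {x} eq = x≢x+1+n 1 (trans eq (ℤₚ.+-assoc x (+ 1) (+ 1)))

x≢x+3 : ∀ {x} → x ≢ x + + 1 + + 1 + + 1
x≢x+3 {x} eq = x≢x+1+n 2 (trans eq (trans (cong (_+ + 1) (ℤₚ.+-assoc x (+ 1) (+ 1))) (ℤₚ.+-assoc x (+ 2) (+ 1))))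

x+1-injective : ∀ {x y} → x + + 1 ≡ y + + 1 → x ≡ y
x+1-injective {x} {y} = ∙-cancelʳ (+ 1) x y

Next-irrefl : ∀ {x} → ¬ Next x x
Next-irrefl (inj₁ e) = x≢x+1+n 0 e
Next-irrefl (inj₂ e) = x≢x+1+n 0 e

Next⇒≢ : ∀ {x y} → Next x y → x ≢ y
Next⇒≢ n refl = Next-irrefl n

Next-sym : ∀ {x y} → Next x y → Next y x
Next-sym (inj₁ e) = inj₂ e
Next-sym (inj₂ e) = inj₁ e

Next-triangle : ∀ {x y z} → Next x y → Next y z → ¬ Next x z
Next-triangle (inj₁ refl) (inj₁ refl) (inj₁ e) = x≢x+1+n 0 (sym e)
Next-triangle (inj₁ refl) (inj₁ refl) (inj₂ e) = x≢x+3 e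
Next-triangle (inj₁ refl) (inj₂ e) n = Next⇒≢ n (x+1-injective e)
Next-triangle (inj₂ refl) (inj₁ refl) n = Next-irrefl n
Next-triangle (inj₂ refl) (inj₂ refl) (inj₁ e) = x≢x+3 e
Next-triangle (inj₂ refl) (inj₂ refl) (inj₂ e) = x≢x+1+n 0 (sym e)

within? : ∀ x c → Dec (Within x c)
within? x c = x ℤₚ.≟ c ⊎-dec x ℤₚ.≟ (c + + 1)

within-next : ∀ {x y c} → Within x c → Within y c → x ≢ y → Next x y
within-next (inj₁ refl) (inj₁ refl) ne = ⊥-elim (ne refl)
within-next (inj₁ refl) (inj₂ refl) ne = inj₁ refl
within-next (inj₂ refl) (inj₁ refl) ne = inj₂ refl
within-next (inj₂ refl) (inj₂ refl) ne = ⊥-elim (ne refl)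

other : ∀ {x c} → Within x c → ∃[ y ] (Within y c × x ≢ y)
other {c = c} (inj₁ refl) = c + + 1 , inj₂ refl , x≢x+1+n 0
other {c = c} (inj₂ refl) = c , inj₁ refl , λ e → x≢x+1+n 0 (sym e)

other-unique : ∀ {x y z c} → Within x c → Within y c → Within z c → y ≢ x → z ≢ x → y ≡ z
other-unique wx (inj₁ refl) (inj₁ refl) _ _ = refl
other-unique wx (inj₂ refl) (inj₂ refl) _ _ = refl
other-unique (inj₁ refl) (inj₁ refl) (inj₂ refl) ne _ = ⊥-elim (ne refl)
other-unique (inj₂ refl) (inj₁ refl) (inj₂ refl) _ ne = ⊥-elim (ne refl)
other-unique (inj₁ refl) (inj₂ refl) (inj₁ refl) _ ne = ⊥-elim (ne refl)
other-unique (inj₂ refl) (inj₂ refl) (inj₁ refl) ne _ = ⊥-elim (ne refl)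

interval-unique : ∀ {x y c d} → x ≢ y → Within x c → Within y c → Within x d → Within y d → c ≡ d
interval-unique ne (inj₁ refl) (inj₁ refl) _ _ = ⊥-elim (ne refl)
interval-unique ne (inj₂ refl) (inj₂ refl) _ _ = ⊥-elim (ne refl)
interval-unique ne (inj₁ refl) (inj₂ refl) (inj₁ refl) _ = refl
interval-unique ne (inj₁ refl) (inj₂ refl) (inj₂ refl) (inj₁ e) = ⊥-elim (x≢x+2 (sym e))
interval-unique ne (inj₁ refl) (inj₂ refl) (inj₂ refl) (inj₂ e) = ⊥-elim (ne (sym e))
interval-unique ne (inj₂ refl) (inj₁ refl) _ (inj₁ refl) = refl
interval-unique ne (inj₂ refl) (inj₁ refl) (inj₁ e) (inj₂ refl) = ⊥-elim (x≢x+2 (sym e))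
interval-unique ne (inj₂ refl) (inj₁ refl) (inj₂ e) (inj₂ refl) = ⊥-elim (ne e)

-- At most two unit intervals have `x` as an end, so the one different from `d` is determined.
interval-other : ∀ {x a c d} → a ≢ d → Within x a → Within x c → Within x d → c ≢ d → c ≡ a
interval-other ne (inj₁ refl) (inj₁ refl) _ _ = refl
interval-other ne (inj₁ refl) _ (inj₁ refl) _ = ⊥-elim (ne refl)
interval-other ne _ (inj₁ refl) (inj₁ refl) ne' = ⊥-elim (ne' refl)
interval-other ne (inj₂ refl) (inj₂ e) _ _ = x+1-injective (sym e)
interval-other ne (inj₂ refl) _ (inj₂ e) _ = ⊥-elim (ne (x+1-injective e))
interval-other ne _ (inj₂ refl) (inj₂ e) ne' = ⊥-elim (ne' (x+1-injective e))

interval-≢ : ∀ {c d} → c ≢ d → ∃[ x ] (Within x c × ¬ Within x d)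
interval-≢ {c} {d} ne with c ℤₚ.≟ (d + + 1)
... | yes refl = d + + 1 + + 1 , inj₂ refl ,
  λ { (inj₁ e) → x≢x+2 (sym e) ; (inj₂ e) → x≢x+1+n 0 (sym e) }
... | no ne' = c , inj₁ refl , λ { (inj₁ e) → ne e ; (inj₂ e) → ne' e }

-- The end `d` already works unless `x` is just to its left, the only case in which the other end is
-- needed.
far-end : ∀ {x d} → ¬ Within x d → ∃[ y ] (Within y d × Far x y)
far-end {x} {d} x∉ with d ℤₚ.≟ (x + + 1)
... | yes refl = x + + 1 + + 1 , inj₂ refl , x≢x+2 ,
  λ { (inj₁ e) → x≢x+1+n 0 (sym e) ; (inj₂ e) → x≢x+3 e }
... | no ne = d , inj₁ refl , (λ e → x∉ (inj₁ e)) , λ { (inj₁ e) → ne e ; (inj₂ e) → x∉ (inj₂ e) }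

-- Frames: in frame true the two coordinates are exchanged.

fst snd : Bool → Point → ℤ
fst false = proj₁
fst true = proj₂
snd false = proj₂
snd true = proj₁

at : Bool → ℤ → ℤ → Point
at false x y = x , y
at true x y = y , x

at-eta : ∀ o p → at o (fst o p) (snd o p) ≡ p
at-eta false p = refl
at-eta true p = refl

point-≡ : ∀ o {p q} → fst o p ≡ fst o q → snd o p ≡ snd o q → p ≡ q
point-≡ false refl refl = refl
point-≡ true refl refl = refl

-- A cell as a product of two unit intervals instead of a list of four points, so that
-- one-dimensional facts apply to each coordinate separately.
_∈□_ : Point → Point → Set
(x , y) ∈□ (c , d) = Within x c × Within y d

∈□⇒SqPt : ∀ {p c} → p ∈□ c → SqPt c p
∈□⇒SqPt (inj₁ refl , inj₁ refl) = inj₁ refl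
∈□⇒SqPt (inj₂ refl , inj₁ refl) = inj₂ (inj₁ refl)
∈□⇒SqPt (inj₁ refl , inj₂ refl) = inj₂ (inj₂ (inj₁ refl))
∈□⇒SqPt (inj₂ refl , inj₂ refl) = inj₂ (inj₂ (inj₂ refl))

SqPt⇒∈□ : ∀ {p c} → SqPt c p → p ∈□ c
SqPt⇒∈□ (inj₁ refl) = inj₁ refl , inj₁ refl
SqPt⇒∈□ (inj₂ (inj₁ refl)) = inj₂ refl , inj₁ refl
SqPt⇒∈□ (inj₂ (inj₂ (inj₁ refl))) = inj₁ refl , inj₂ refl
SqPt⇒∈□ (inj₂ (inj₂ (inj₂ refl))) = inj₂ refl , inj₂ refl

∈□⇒∈ : ∀ {V p c} → Square V c → p ∈□ c → p ∈ V
∈□⇒∈ (s , _) (inj₁ refl , inj₁ refl) = s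
∈□⇒∈ (_ , s , _) (inj₂ refl , inj₁ refl) = s
∈□⇒∈ (_ , _ , s , _) (inj₁ refl , inj₂ refl) = s
∈□⇒∈ (_ , _ , _ , s) (inj₂ refl , inj₂ refl) = s

∈⇒Square : ∀ {V} c → (∀ p → p ∈□ c → p ∈ V) → Square V c
∈⇒Square c f = f _ (inj₁ refl , inj₁ refl) , f _ (inj₂ refl , inj₁ refl) ,
               f _ (inj₁ refl , inj₂ refl) , f _ (inj₂ refl , inj₂ refl)

_∈□?_ : ∀ p c → Dec (p ∈□ c)
(x , y) ∈□? (c , d) = within? x c ×-dec within? y d

∈□-fst : ∀ o {p c} → p ∈□ c → Within (fst o p) (fst o c)
∈□-fst false = proj₁
∈□-fst true = proj₂

∈□-snd : ∀ o {p c} → p ∈□ c → Within (snd o p) (snd o c)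
∈□-snd false = proj₂
∈□-snd true = proj₁

∈□-intro : ∀ o {p c} → Within (fst o p) (fst o c) → Within (snd o p) (snd o c) → p ∈□ c
∈□-intro false a b = a , b
∈□-intro true a b = b , a

∈□-at : ∀ o {x y c} → Within x (fst o c) → Within y (snd o c) → at o x y ∈□ c
∈□-at false a b = a , b
∈□-at true a b = b , a

at-∈□ : ∀ o {x y c} → at o x y ∈□ c → Within x (fst o c) × Within y (snd o c)
at-∈□ false (a , b) = a , b
at-∈□ true (a , b) = b , a

∈□-at-at : ∀ o {x y c d} → Within x c → Within y d → at o x y ∈□ at o c d
∈□-at-at false a b = a , b
∈□-at-at true a b = b , a

fst-at : ∀ o {x y} → fst o (at o x y) ≡ x
fst-at false = refl
fst-at true = refl

snd-at : ∀ o {x y} → snd o (at o x y) ≡ y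
snd-at false = refl
snd-at true = refl

Adj-snd : ∀ o {x y y'} → Next y y' → Adj (at o x y) (at o x y')
Adj-snd false n = inj₁ (refl , n)
Adj-snd true n = inj₂ (refl , n)

Adj-fst : ∀ o {x x' y} → Next x x' → Adj (at o x y) (at o x' y)
Adj-fst false n = inj₂ (refl , n)
Adj-fst true n = inj₁ (refl , n)

frame-cases : ∀ o o' → o' ≡ o ⊎ (∀ p → fst o' p ≡ snd o p × snd o' p ≡ fst o p)
frame-cases false false = inj₁ refl
frame-cases false true = inj₂ λ p → refl , refl
frame-cases true false = inj₂ λ p → refl , refl
frame-cases true true = inj₁ refl

same-fst⇒Adj : ∀ o {p q} → fst o p ≡ fst o q → Next (snd o p) (snd o q) → Adj p q
same-fst⇒Adj false e n = inj₁ (e , n)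
same-fst⇒Adj true e n = inj₂ (e , n)

same-snd⇒Adj : ∀ o {p q} → snd o p ≡ snd o q → Next (fst o p) (fst o q) → Adj p q
same-snd⇒Adj false e n = inj₂ (e , n)
same-snd⇒Adj true e n = inj₁ (e , n)

Adj-axis : ∀ {p q} → Adj p q → ∃[ o ] (fst o p ≡ fst o q × Next (snd o p) (snd o q))
Adj-axis (inj₁ a) = false , a
Adj-axis (inj₂ a) = true , a

Adj-sym : ∀ {p q} → Adj p q → Adj q p
Adj-sym (inj₁ (e , n)) = inj₁ (sym e , Next-sym n)
Adj-sym (inj₂ (e , n)) = inj₂ (sym e , Next-sym n)

Adj-irrefl : ∀ {p} → ¬ Adj p p
Adj-irrefl (inj₁ (_ , n)) = Next-irrefl n
Adj-irrefl (inj₂ (_ , n)) = Next-irrefl n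

Adj-triangle : ∀ {p q r} → Adj p q → Adj q r → ¬ Adj p r
Adj-triangle (inj₁ (refl , m)) (inj₁ (refl , n)) (inj₁ (_ , k)) = Next-triangle m n k
Adj-triangle (inj₁ (refl , m)) (inj₁ (refl , n)) (inj₂ (_ , k)) = Next-irrefl k
Adj-triangle (inj₁ (refl , m)) (inj₂ (refl , n)) (inj₁ (refl , k)) = Next-irrefl n
Adj-triangle (inj₁ (refl , m)) (inj₂ (refl , n)) (inj₂ (refl , k)) = Next-irrefl m
Adj-triangle (inj₂ (refl , m)) (inj₁ (refl , n)) (inj₁ (refl , k)) = Next-irrefl m
Adj-triangle (inj₂ (refl , m)) (inj₁ (refl , n)) (inj₂ (refl , k)) = Next-irrefl n
Adj-triangle (inj₂ (refl , m)) (inj₂ (refl , n)) (inj₁ (_ , k)) = Next-irrefl k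
Adj-triangle (inj₂ (refl , m)) (inj₂ (refl , n)) (inj₂ (_ , k)) = Next-triangle m n k

¬Adj-diagonal : ∀ o {x y x' y'} → x ≢ x' → y ≢ y' → ¬ Adj (at o x y) (at o x' y')
¬Adj-diagonal false a b (inj₁ (e , _)) = a e
¬Adj-diagonal false a b (inj₂ (e , _)) = b e
¬Adj-diagonal true a b (inj₁ (e , _)) = b e
¬Adj-diagonal true a b (inj₂ (e , _)) = a e

¬Adj-far : ∀ o {x y x' y'} → Far y y' → ¬ Adj (at o x y) (at o x' y')
¬Adj-far false (a , b) (inj₁ (_ , n)) = b n
¬Adj-far false (a , b) (inj₂ (e , _)) = a e
¬Adj-far true (a , b) (inj₁ (e , _)) = a e
¬Adj-far true (a , b) (inj₂ (_ , n)) = b n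

-- Induced matchings between two cells

InducedMatching : Point → Point → Point → Point → Set
InducedMatching p q p' q' =
  Adj p q × Adj p' q' × ¬ Adj p p' × ¬ Adj p q' × ¬ Adj q p' × ¬ Adj q q'

-- As `v` is outside `d` in the second frame coordinate, some side of `d` parallel to the first axis
-- is at distance at least two from it in that coordinate. The neighbour `u` of `v` along the first
-- axis has the same second coordinate, so this one distance rules out all four cross edges.
separate-frame : ∀ o {v c d} → v ∈□ c → ¬ Within (snd o v) (snd o d) →
  ∃[ u ] ∃[ p ] ∃[ q ] (u ∈□ c × p ∈□ d × q ∈□ d × InducedMatching v u p q)
separate-frame o {v} {c} {d} v∈ out
  with other (∈□-fst o v∈) | far-end out
... | x , x∈ , v≢x | y , y∈ , far =
  at o x (snd o v) , at o (fst o d) y , at o (fst o d + + 1) y ,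
  ∈□-at o x∈ (∈□-snd o v∈) , ∈□-at o (inj₁ refl) y∈ , ∈□-at o (inj₂ refl) y∈ ,
  subst (λ p → Adj p (at o x (snd o v))) (at-eta o v) (Adj-fst o (within-next (∈□-fst o v∈) x∈ v≢x)) ,
  Adj-fst o (inj₁ refl) ,
  subst (λ p → ¬ Adj p (at o (fst o d) y)) (at-eta o v) (¬Adj-far o far) ,
  subst (λ p → ¬ Adj p (at o (fst o d + + 1) y)) (at-eta o v) (¬Adj-far o far) ,
  ¬Adj-far o far , ¬Adj-far o far

separate : ∀ {v c d} → v ∈□ c → ¬ v ∈□ d →
  ∃[ u ] ∃[ p ] ∃[ q ] (u ∈□ c × p ∈□ d × q ∈□ d × InducedMatching v u p q)
separate {v} {c} {d} v∈ v∉ with within? (proj₂ v) (proj₂ d)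
... | no out = separate-frame false {d = d} v∈ out
... | yes w₂ = separate-frame true {d = d} v∈ (λ w₁ → v∉ (w₁ , w₂))

cell-≢ : ∀ {c d} → c ≢ d → ∃[ v ] (v ∈□ c × ¬ v ∈□ d)
cell-≢ {c₁ , c₂} {d₁ , d₂} ne with c₁ ℤₚ.≟ d₁
... | no ne₁ = let x , x∈ , x∉ = interval-≢ ne₁ in
               (x , c₂) , (x∈ , inj₁ refl) , λ i → x∉ (proj₁ i)
... | yes refl = let y , y∈ , y∉ = interval-≢ (λ e → ne (cong (c₁ ,_) e)) in
                 (c₁ , y) , (inj₁ refl , y∈) , λ i → y∉ (proj₂ i)

-- Vertex intervals over a linear order of the squares

record Chain (V : List Point) (low : Point → Bool) : Set₁ where
  infix 4 _≺_
  field
    _≺_ : Point → Point → Set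
    ≺-irrefl : ∀ {c} → ¬ c ≺ c
    ≺-trans : ∀ {c d e} → c ≺ d → d ≺ e → c ≺ e
    ≺-cmp : ∀ {c d} → Square V c → Square V d → c ≺ d ⊎ c ≡ d ⊎ d ≺ c
    convex : ∀ {c d e v} → Square V c → Square V d → Square V e →
             c ≺ d → d ≺ e → v ∈□ c → v ∈□ e → v ∈□ d
    lo hi : Point → Point
    lo-□ : ∀ {v} → v ∈ V → Square V (lo v)
    hi-□ : ∀ {v} → v ∈ V → Square V (hi v)
    lo-∋ : ∀ {v} → v ∈ V → v ∈□ lo v
    hi-∋ : ∀ {v} → v ∈ V → v ∈□ hi v
    lo-least : ∀ {v c} → Square V c → v ∈□ c → ¬ c ≺ lo v
    hi-greatest : ∀ {v c} → Square V c → v ∈□ c → ¬ hi v ≺ c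
    low-adj : ∀ {c p q} → Square V c → p ∈□ c → q ∈□ c → Adj p q → low p ≢ low q
    low-diag : ∀ {c p q} → Square V c → p ∈□ c → q ∈□ c →
               proj₁ p ≢ proj₁ q → proj₂ p ≢ proj₂ q → low p ≡ low q

-- The axioms are symmetric under reversal of the order, which exchanges first and last cells and
-- leaves the classes alone. Geometry proved around the last cell of `m` thereby also serves high
-- corners, where the first cell of `m` takes its place.
reverse : ∀ {V low} → Chain V low → Chain V low
reverse {V} R = record
  { _≺_ = λ c d → d ≺ c
  ; ≺-irrefl = ≺-irrefl
  ; ≺-trans = λ p q → ≺-trans q p
  ; ≺-cmp = λ c d → map₂ (map₁ sym) (≺-cmp d c)
  ; convex = λ c d e p q i j → convex e d c q p j i
  ; lo = hi ; hi = lo ; lo-□ = hi-□ ; hi-□ = lo-□ ; lo-∋ = hi-∋ ; hi-∋ = lo-∋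
  ; lo-least = hi-greatest ; hi-greatest = lo-least
  ; low-adj = low-adj ; low-diag = low-diag
  }
  where open Chain R

module ChainProperties {V : List Point} {low : Point → Bool} (R : Chain V low) where

  open Chain R

  lo-≺ : ∀ {v c d} → v ∈ V → Square V c → v ∈□ c → c ≺ d → lo v ≺ d
  lo-≺ v∈ c□ v∈c c≺d with ≺-cmp (lo-□ v∈) c□
  ... | inj₁ p = ≺-trans p c≺d
  ... | inj₂ (inj₁ refl) = c≺d
  ... | inj₂ (inj₂ p) = ⊥-elim (lo-least c□ v∈c p)

  ≺-hi : ∀ {v c d} → v ∈ V → Square V d → v ∈□ d → c ≺ d → c ≺ hi v
  ≺-hi v∈ d□ v∈d c≺d with ≺-cmp (hi-□ v∈) d□
  ... | inj₁ p = ⊥-elim (hi-greatest d□ v∈d p)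
  ... | inj₂ (inj₁ refl) = c≺d
  ... | inj₂ (inj₂ p) = ≺-trans c≺d p

  same⇒fst≢ : ∀ o {c p q} → Square V c → p ∈□ c → q ∈□ c → low p ≡ low q → p ≢ q → fst o p ≢ fst o q
  same⇒fst≢ o c□ p∈ q∈ ty p≢q e = low-adj c□ p∈ q∈
    (same-fst⇒Adj o e (within-next (∈□-snd o p∈) (∈□-snd o q∈) (λ e' → p≢q (point-≡ o e e')))) ty

  same⇒snd≢ : ∀ o {c p q} → Square V c → p ∈□ c → q ∈□ c → low p ≡ low q → p ≢ q → snd o p ≢ snd o q
  same⇒snd≢ o c□ p∈ q∈ ty p≢q e = low-adj c□ p∈ q∈
    (same-snd⇒Adj o e (within-next (∈□-fst o p∈) (∈□-fst o q∈) (λ e' → p≢q (point-≡ o e' e)))) ty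

  diagonal⇒same : ∀ o {c p q} → Square V c → p ∈□ c → q ∈□ c → fst o p ≢ fst o q → snd o p ≢ snd o q → low p ≡ low q
  diagonal⇒same false c□ p∈ q∈ a b = low-diag c□ p∈ q∈ a b
  diagonal⇒same true c□ p∈ q∈ a b = low-diag c□ p∈ q∈ b a

  -- Two vertices of one class in a cell are opposite, so each has a single companion there.
  third-unique : ∀ {c p q m} → Square V c → p ∈□ c → q ∈□ c → m ∈□ c →
    low p ≡ low m → low q ≡ low m → p ≢ m → q ≢ m → p ≡ q
  third-unique c□ p∈ q∈ m∈ tp tq p≢ q≢ = point-≡ false
    (other-unique (proj₁ m∈) (proj₁ p∈) (proj₁ q∈) (same⇒fst≢ false c□ p∈ m∈ tp p≢) (same⇒fst≢ false c□ q∈ m∈ tq q≢))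
    (other-unique (proj₂ m∈) (proj₂ p∈) (proj₂ q∈) (same⇒fst≢ true c□ p∈ m∈ tp p≢) (same⇒fst≢ true c□ q∈ m∈ tq q≢))

  diagonal-unique : ∀ {c d p q} → Square V c → Square V d → p ∈□ c → q ∈□ c → p ∈□ d → q ∈□ d →
    low p ≡ low q → p ≢ q → c ≡ d
  diagonal-unique c□ d□ pc qc pd qd ty ne = point-≡ false
    (interval-unique (same⇒fst≢ false c□ pc qc ty ne) (proj₁ pc) (proj₁ qc) (proj₁ pd) (proj₁ qd))
    (interval-unique (same⇒fst≢ true c□ pc qc ty ne) (proj₂ pc) (proj₂ qc) (proj₂ pd) (proj₂ qd))

  record Turn (a d b : Point) (o : Bool) : Set where
    field
      fst-ad : fst o a ≢ fst o d
      snd-ad : snd o a ≡ snd o d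
      fst-bd : fst o b ≡ fst o d
      snd-bd : snd o b ≢ snd o d

  -- Otherwise the vertex next to m in the first frame direction, away from d,
  -- would lie in a and b but not in the cell d between them.
  not-both : ∀ o {a d b m} → Square V a → Square V d → Square V b →
    m ∈□ a → m ∈□ d → m ∈□ b → a ≺ d → d ≺ b → fst o a ≢ fst o d → fst o b ≢ fst o d → ⊥
  not-both o {a} {d} {b} {m} a□ d□ b□ ma md mb a≺d d≺b a≢d b≢d
    with other (∈□-fst o ma)
  ... | x , x∈a , m≢x = a≢d (interval-unique m≢x (∈□-fst o ma) x∈a (∈□-fst o md)
          (proj₁ (at-∈□ o {c = d} (convex a□ d□ b□ a≺d d≺b
            (∈□-at o {c = a} x∈a (∈□-snd o ma))
            (∈□-at o {c = b} (subst (Within x) a≡b x∈a) (∈□-snd o mb))))))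
    where
    a≡b : fst o a ≡ fst o b
    a≡b = sym (interval-other a≢d (∈□-fst o ma) (∈□-fst o mb) (∈□-fst o md) b≢d)

  -- Each of `a` and `b` differs from `d` in some coordinate, and `not-both` allows each coordinate
  -- to be changed by only one of them. Hence both are edge neighbours of `d`, in perpendicular
  -- directions.
  turn : ∀ {a d b m} → Square V a → Square V d → Square V b →
    m ∈□ a → m ∈□ d → m ∈□ b → a ≺ d → d ≺ b → ∃[ o ] Turn a d b o
  turn {a} {d} {b} a□ d□ b□ ma md mb a≺d d≺b
    with proj₁ a ℤₚ.≟ proj₁ d | proj₂ a ℤₚ.≟ proj₂ d | proj₁ b ℤₚ.≟ proj₁ d | proj₂ b ℤₚ.≟ proj₂ d
  ... | yes refl | yes refl | _ | _ = ⊥-elim (≺-irrefl a≺d)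
  ... | _ | _ | yes refl | yes refl = ⊥-elim (≺-irrefl d≺b)
  ... | no n | _ | no n' | _ = ⊥-elim (not-both false a□ d□ b□ ma md mb a≺d d≺b n n')
  ... | _ | no n | _ | no n' = ⊥-elim (not-both true a□ d□ b□ ma md mb a≺d d≺b n n')
  ... | no n | yes e | yes e' | no n' = false , record { fst-ad = n ; snd-ad = e ; fst-bd = e' ; snd-bd = n' }
  ... | yes e | no n | no n' | yes e' = true , record { fst-ad = n ; snd-ad = e ; fst-bd = e' ; snd-bd = n' }

  -- A vertex v whose cells lie strictly between the extreme cells of a vertex m
  -- of its class; this turns out to say that v is a corner and m is opposite to it.
  record Inside (v m : Point) : Set where
    field
      v∈V : v ∈ V
      m∈V : m ∈ V
      same : low v ≡ low m
      lo≺ : lo m ≺ lo v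
      hi≺ : hi v ≺ hi m

  module InsideProperties {v m : Point} (I : Inside v m) where
    open Inside I

    a d b : Point
    a = lo m
    d = lo v
    b = hi m

    a□ : Square V a
    a□ = lo-□ m∈V
    d□ : Square V d
    d□ = lo-□ v∈V
    b□ : Square V b
    b□ = hi-□ m∈V

    a≺d : a ≺ d
    a≺d = lo≺

    between : ∀ {c} → Square V c → v ∈□ c → a ≺ c × c ≺ b
    between c□ v∈c with ≺-cmp (lo-□ v∈V) c□ | ≺-cmp c□ (hi-□ v∈V)
    ... | inj₂ (inj₂ p) | _ = ⊥-elim (lo-least c□ v∈c p)
    ... | _ | inj₂ (inj₂ p) = ⊥-elim (hi-greatest c□ v∈c p)
    ... | inj₁ p | inj₁ q = ≺-trans lo≺ p , ≺-trans q hi≺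
    ... | inj₁ p | inj₂ (inj₁ refl) = ≺-trans lo≺ p , hi≺
    ... | inj₂ (inj₁ refl) | inj₁ q = lo≺ , ≺-trans q hi≺
    ... | inj₂ (inj₁ refl) | inj₂ (inj₁ e) = lo≺ , subst (_≺ b) (sym e) hi≺

    d≺b : d ≺ b
    d≺b = proj₂ (between d□ (lo-∋ v∈V))

    m∈a : m ∈□ a
    m∈a = lo-∋ m∈V
    m∈b : m ∈□ b
    m∈b = hi-∋ m∈V

    m∈ : ∀ {c} → Square V c → v ∈□ c → m ∈□ c
    m∈ c□ v∈c = convex a□ c□ b□ (proj₁ (between c□ v∈c)) (proj₂ (between c□ v∈c)) m∈a m∈b

    v∈d : v ∈□ d
    v∈d = lo-∋ v∈V
    m∈d : m ∈□ d
    m∈d = m∈ d□ v∈d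

    v≢m : v ≢ m
    v≢m refl = ≺-irrefl lo≺

    -- By convexity every cell of `v` also contains `m`, and two distinct vertices of one class
    -- determine their common cell.
    only : ∀ {c} → Square V c → v ∈□ c → c ≡ d
    only c□ v∈c = diagonal-unique c□ d□ v∈c (m∈ c□ v∈c) v∈d m∈d same v≢m

    hi≡lo : hi v ≡ d
    hi≡lo = only (hi-□ v∈V) (hi-∋ v∈V)

    o : Bool
    o = proj₁ (turn a□ d□ b□ m∈a m∈d m∈b a≺d d≺b)

    open Turn (proj₂ (turn a□ d□ b□ m∈a m∈d m∈b a≺d d≺b)) public

    -- In frame o, the cells are a = [x⁻,x]×[y,y⁺], d = [x,x⁺]×[y,y⁺] and
    -- b = [x,x⁺]×[y⁻,y], with m = (x,y) and v = (x⁺,y⁺).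
    x y x⁺ y⁺ x⁻ y⁻ : ℤ
    x = fst o m
    y = snd o m
    x⁺ = fst o v
    y⁺ = snd o v
    x⁻ = proj₁ (other (∈□-fst o m∈a))
    y⁻ = proj₁ (other (∈□-snd o m∈b))

    x∈a : Within x (fst o a)
    x∈a = ∈□-fst o m∈a
    x∈d : Within x (fst o d)
    x∈d = ∈□-fst o m∈d
    x∈b : Within x (fst o b)
    x∈b = ∈□-fst o m∈b
    y∈a : Within y (snd o a)
    y∈a = ∈□-snd o m∈a
    y∈d : Within y (snd o d)
    y∈d = ∈□-snd o m∈d
    y∈b : Within y (snd o b)
    y∈b = ∈□-snd o m∈b
    x⁺∈d : Within x⁺ (fst o d)
    x⁺∈d = ∈□-fst o v∈d
    x⁺∈b : Within x⁺ (fst o b)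
    x⁺∈b = subst (Within x⁺) (sym fst-bd) x⁺∈d
    y⁺∈d : Within y⁺ (snd o d)
    y⁺∈d = ∈□-snd o v∈d
    y⁺∈a : Within y⁺ (snd o a)
    y⁺∈a = subst (Within y⁺) (sym snd-ad) y⁺∈d
    x⁻∈a : Within x⁻ (fst o a)
    x⁻∈a = proj₁ (proj₂ (other x∈a))
    y⁻∈b : Within y⁻ (snd o b)
    y⁻∈b = proj₁ (proj₂ (other y∈b))
    x≢x⁻ : x ≢ x⁻
    x≢x⁻ = proj₂ (proj₂ (other x∈a))
    y≢y⁻ : y ≢ y⁻
    y≢y⁻ = proj₂ (proj₂ (other y∈b))
    x⁺≢x : x⁺ ≢ x
    x⁺≢x = same⇒fst≢ o d□ v∈d m∈d same v≢m
    y⁺≢y : y⁺ ≢ y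
    y⁺≢y = same⇒snd≢ o d□ v∈d m∈d same v≢m

    x⁻∉d : ¬ Within x⁻ (fst o d)
    x⁻∉d w = fst-ad (interval-unique x≢x⁻ x∈a x⁻∈a x∈d w)
    y⁻∉d : ¬ Within y⁻ (snd o d)
    y⁻∉d w = snd-bd (interval-unique y≢y⁻ y∈b y⁻∈b y∈d w)
    x⁺≢x⁻ : x⁺ ≢ x⁻
    x⁺≢x⁻ e = x⁻∉d (subst (λ z → Within z (fst o d)) e x⁺∈d)
    y⁺≢y⁻ : y⁺ ≢ y⁻
    y⁺≢y⁻ e = y⁻∉d (subst (λ z → Within z (snd o d)) e y⁺∈d)

    -- The edge from `m` to (x⁺,y) lies in `d` and in `b`, hence in every cell between them; but an
    -- edge lies in at most two cells.
    nothing-between : ∀ {e} → Square V e → d ≺ e → e ≺ b → ⊥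
    nothing-between {e} e□ d≺e e≺b = excluded
      where
      q∈e : at o x⁺ y ∈□ e
      q∈e = convex d□ e□ b□ d≺e e≺b (∈□-at o {c = d} x⁺∈d y∈d) (∈□-at o {c = b} x⁺∈b y∈b)
      m∈e : m ∈□ e
      m∈e = convex d□ e□ b□ d≺e e≺b m∈d m∈b
      fst≡ : fst o e ≡ fst o d
      fst≡ = interval-unique x⁺≢x (proj₁ (at-∈□ o {c = e} q∈e)) (∈□-fst o m∈e) x⁺∈d x∈d
      excluded : ⊥
      excluded with snd o e ℤₚ.≟ snd o d
      ... | yes p = ≺-irrefl (subst (d ≺_) (point-≡ o fst≡ p) d≺e)
      ... | no p = ≺-irrefl (subst (_≺ b) (point-≡ o (trans fst≡ (sym fst-bd))
                     (interval-other snd-bd y∈b (∈□-snd o m∈e) y∈d p)) e≺b)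

    -- An earlier first cell would be `d` itself, or precede `d`, whereupon convexity puts `z` into
    -- `d`, or fall strictly between `d` and `b`.
    lo-in-b : ∀ {z} → z ∈ V → z ∈□ b → ¬ z ∈□ d → lo z ≡ b
    lo-in-b {z} z∈V z∈b z∉d with ≺-cmp (lo-□ z∈V) b□
    ... | inj₂ (inj₁ e) = e
    ... | inj₂ (inj₂ p) = ⊥-elim (lo-least b□ z∈b p)
    ... | inj₁ p with ≺-cmp (lo-□ z∈V) d□
    ...   | inj₁ q = ⊥-elim (z∉d (convex (lo-□ z∈V) d□ b□ q d≺b (lo-∋ z∈V) z∈b))
    ...   | inj₂ (inj₁ e) = ⊥-elim (z∉d (subst (z ∈□_) e (lo-∋ z∈V)))
    ...   | inj₂ (inj₂ q) = ⊥-elim (nothing-between (lo-□ z∈V) q p)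

    s : Point
    s = at o x y⁻

    s∈b : s ∈□ b
    s∈b = ∈□-at o {c = b} x∈b y⁻∈b

    s∈V : s ∈ V
    s∈V = ∈□⇒∈ b□ s∈b

    s∉d : ¬ s ∈□ d
    s∉d i = y⁻∉d (proj₂ (at-∈□ o {c = d} i))

    s~m : Adj s m
    s~m = same-fst⇒Adj o (fst-at o) (subst (λ z → Next z y) (sym (snd-at o))
            (within-next y⁻∈b y∈b (λ e → y≢y⁻ (sym e))))

    s-class : low s ≢ low m
    s-class = low-adj b□ s∈b m∈b s~m

    lo-s : lo s ≡ b
    lo-s = lo-in-b s∈V s∈b s∉d

    -- Besides s, the only vertex of b adjacent to m is (x⁺,y), which lies in d as well.
    s-unique : ∀ {z} → z ∈ V → low z ≢ low m → d ≺ lo z → ¬ b ≺ lo z → z ≡ s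
    s-unique {z} z∈V ne d≺z b⊀z = z≡s
      where
      lo-z : lo z ≡ b
      lo-z with ≺-cmp (lo-□ z∈V) b□
      ... | inj₁ p = ⊥-elim (nothing-between (lo-□ z∈V) d≺z p)
      ... | inj₂ (inj₁ e) = e
      ... | inj₂ (inj₂ p) = ⊥-elim (b⊀z p)
      z∈b : z ∈□ b
      z∈b = subst (z ∈□_) lo-z (lo-∋ z∈V)
      z≢y : snd o z ≢ y
      z≢y e = lo-least d□ (∈□-intro o {p = z} {c = d} (subst (Within (fst o z)) fst-bd (∈□-fst o z∈b))
                (subst (λ k → Within k (snd o d)) (sym e) y∈d)) d≺z
      z≡x : fst o z ≡ x
      z≡x with fst o z ℤₚ.≟ x
      ... | yes e = e
      ... | no n = ⊥-elim (ne (diagonal⇒same o b□ z∈b m∈b n z≢y))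
      z≡s : z ≡ s
      z≡s = point-≡ o (trans z≡x (sym (fst-at o)))
        (trans (other-unique y∈b (∈□-snd o z∈b) y⁻∈b z≢y (λ e → y≢y⁻ (sym e))) (sym (snd-at o)))

    -- The cell `d` holds two vertices of this class, and `m` is excluded because its last cell is
    -- later. Within the class, ties in the last cell therefore never occur at `v`.
    v-unique : ∀ {z} → z ∈ V → low z ≡ low m → hi z ≡ d → z ≡ v
    v-unique {z} z∈V ty hi-z = third-unique d□ z∈d v∈d m∈d ty same z≢m v≢m
      where
      z∈d : z ∈□ d
      z∈d = subst (z ∈□_) hi-z (hi-∋ z∈V)
      z≢m : z ≢ m
      z≢m refl = ≺-irrefl (subst (d ≺_) hi-z d≺b)

    -- Such a `z` is opposite `m` in `b`, hence outside `d`, so its first cell is `b`, whereas `m`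
    -- starts already in `a`. This decides the tie-break between `m` and the vertices of its class
    -- that end in the same cell.
    m-first : ∀ {z} → z ∈ V → low z ≡ low m → hi z ≡ b → z ≢ m → a ≺ lo z
    m-first {z} z∈V ty hi-z z≢m = subst (a ≺_) (sym (lo-in-b z∈V z∈b z∉d)) (≺-trans a≺d d≺b)
      where
      z∈b : z ∈□ b
      z∈b = subst (z ∈□_) hi-z (hi-∋ z∈V)
      z∉d : ¬ z ∈□ d
      z∉d z∈d = snd-bd (interval-unique (same⇒snd≢ o b□ z∈b m∈b ty z≢m)
                  (∈□-snd o z∈b) y∈b (∈□-snd o z∈d) y∈d)

    -- If v' were inside s, the cells of s would be b, then d' below b, then b' to the
    -- left of d'; then (x⁻,y⁻) ∈ b' completes a cell c around s and m, impossible
    -- since b is the last cell of m and the first of s.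
    s-not-outer : ∀ {v'} → ¬ Inside v' s
    s-not-outer {v'} I' = excluded
      where
      module I' = Inside I'
      d' b' : Point
      d' = lo v'
      b' = hi s
      d'□ : Square V d'
      d'□ = lo-□ I'.v∈V
      b'□ : Square V b'
      b'□ = hi-□ s∈V
      s∈b' : s ∈□ b'
      s∈b' = hi-∋ s∈V
      lo-s≺d' : lo s ≺ d'
      lo-s≺d' = I'.lo≺
      b≺d' : b ≺ d'
      b≺d' = subst (_≺ d') lo-s lo-s≺d'
      d'≺b' : d' ≺ b'
      d'≺b' with ≺-cmp d'□ (hi-□ I'.v∈V)
      ... | inj₁ p = ≺-trans p I'.hi≺
      ... | inj₂ (inj₁ e) = subst (_≺ b') (sym e) I'.hi≺
      ... | inj₂ (inj₂ p) = ⊥-elim (hi-greatest d'□ (lo-∋ I'.v∈V) p)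
      s∈d' : s ∈□ d'
      s∈d' = convex b□ d'□ b'□ b≺d' d'≺b' s∈b s∈b'
      x∈d' : Within x (fst o d')
      x∈d' = proj₁ (at-∈□ o {c = d'} s∈d')
      x∈b' : Within x (fst o b')
      x∈b' = proj₁ (at-∈□ o {c = b'} s∈b')
      y∉d' : ¬ Within y (snd o d')
      y∉d' w = hi-greatest d'□ (∈□-intro o {p = m} {c = d'} x∈d' w) b≺d'
      corner-cell : fst o b ≡ fst o d' → fst o b' ≢ fst o d' → ⊥
      corner-cell fst-b fst-b' = c-misplaced (≺-cmp b□ c□)
        where
        c : Point
        c = at o (fst o a) (snd o b)
        fst-b'a : fst o b' ≡ fst o a
        fst-b'a = interval-other fst-ad x∈a x∈b' x∈d
          (λ e → fst-b' (trans e (trans (sym fst-bd) fst-b)))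
        c⊆V : ∀ p → p ∈□ c → p ∈ V
        c⊆V p p∈c with snd o p ℤₚ.≟ y
        ... | yes e = ∈□⇒∈ a□ (∈□-intro o {c = a} (subst (Within (fst o p)) (fst-at o) (∈□-fst o p∈c))
                        (subst (λ k → Within k (snd o a)) (sym e) y∈a))
        ... | no n = ∈□⇒∈ b'□ (∈□-intro o {c = b'}
                        (subst (Within (fst o p)) (trans (fst-at o) (sym fst-b'a)) (∈□-fst o p∈c))
                        (subst (λ k → Within k (snd o b'))
                          (other-unique y∈b y⁻∈b (subst (Within (snd o p)) (snd-at o) (∈□-snd o p∈c)) (λ e → y≢y⁻ (sym e)) n)
                          (proj₂ (at-∈□ o {c = b'} s∈b'))))
        c□ : Square V c
        c□ = ∈⇒Square c c⊆V
        c-misplaced : b ≺ c ⊎ b ≡ c ⊎ c ≺ b → ⊥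
        c-misplaced (inj₁ p) = hi-greatest c□ (subst (_∈□ c) (at-eta o m) (∈□-at-at o x∈a y∈b)) p
        c-misplaced (inj₂ (inj₁ e)) = fst-ad (trans (sym (fst-at o)) (trans (cong (fst o) (sym e)) fst-bd))
        c-misplaced (inj₂ (inj₂ p)) = lo-least c□ (∈□-at-at o x∈a y⁻∈b) (subst (c ≺_) (sym lo-s) p)
      excluded : ⊥
      excluded with turn b□ d'□ b'□ s∈b s∈d' s∈b' b≺d' d'≺b'
      ... | o' , T with frame-cases o o'
      ...   | inj₁ refl = y∉d' (subst (Within y) (Turn.snd-ad T) y∈b)
      ...   | inj₂ f = corner-cell
                (trans (sym (proj₂ (f b))) (trans (Turn.snd-ad T) (proj₂ (f d'))))
                (λ e → Turn.snd-bd T (trans (proj₂ (f b')) (trans e (sym (proj₂ (f d'))))))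

    -- The cells `a` and `b` cover all of `d` except `v`, so `v` is the only vertex belonging to `d`
    -- alone; an end-square would have two such vertices.
    inside⇒corner : Corner V v
    inside⇒corner = d , d□ , ∈□⇒SqPt v∈d , (λ c' c'□ i → only c'□ (SqPt⇒∈□ i)) , not-end ,
      a , b , a□ , b□ , (λ e → fst-ad (cong (fst o) e)) , (λ e → snd-bd (cong (snd o) e)) ,
      (λ e → fst-ad (trans (cong (fst o) e) fst-bd)) ,
      (m , at o x y⁺ ,
        subst (λ p → Adj p (at o x y⁺)) (at-eta o m) (Adj-snd o (within-next y∈d y⁺∈d (λ e → y⁺≢y (sym e)))) ,
        ∈□⇒SqPt m∈d , ∈□⇒SqPt (∈□-at o {c = d} x∈d y⁺∈d) , ∈□⇒SqPt m∈a , ∈□⇒SqPt (∈□-at o {c = a} x∈a y⁺∈a)) ,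
      (m , at o x⁺ y ,
        subst (λ p → Adj p (at o x⁺ y)) (at-eta o m) (Adj-fst o (within-next x∈d x⁺∈d (λ e → x⁺≢x (sym e)))) ,
        ∈□⇒SqPt m∈d , ∈□⇒SqPt (∈□-at o {c = d} x⁺∈d y∈d) , ∈□⇒SqPt m∈b , ∈□⇒SqPt (∈□-at o {c = b} x⁺∈b y∈b))
      where
      private-is-v : ∀ {p} → p ∈□ d → OnlyIn V d p → p ≡ v
      private-is-v {p} p∈d priv with fst o p ℤₚ.≟ x⁺ | snd o p ℤₚ.≟ y⁺
      ... | yes e | yes e' = point-≡ o e e'
      ... | no n | _ = ⊥-elim (fst-ad (cong (fst o) (priv a a□ (∈□⇒SqPt (∈□-intro o {c = a}
              (subst (λ k → Within k (fst o a))
                (other-unique x⁺∈d x∈d (∈□-fst o p∈d) (λ e → x⁺≢x (sym e)) n) x∈a)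
              (subst (Within (snd o p)) (sym snd-ad) (∈□-snd o p∈d)))))))
      ... | _ | no n = ⊥-elim (snd-bd (cong (snd o) (priv b b□ (∈□⇒SqPt (∈□-intro o {c = b}
              (subst (Within (fst o p)) (sym fst-bd) (∈□-fst o p∈d))
              (subst (λ k → Within k (snd o b))
                (other-unique y⁺∈d y∈d (∈□-snd o p∈d) (λ e → y⁺≢y (sym e)) n) y∈b))))))
      not-end : ¬ EndSquare V d
      not-end (p , q , p∈ , q∈ , p~q , priv-p , priv-q)
        with private-is-v (SqPt⇒∈□ p∈) priv-p | private-is-v (SqPt⇒∈□ q∈) priv-q
      ... | refl | refl = Adj-irrefl {v} p~q

  -- The cell `b` depends on `m` only. If the cells of `v` and `v'` differed, one of them would fall
  -- between the other and `b`.
  inner-unique : ∀ {v v' m} → Inside v m → Inside v' m → v ≡ v'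
  inner-unique {v} {v'} I I' with ≺-cmp (lo-□ (Inside.v∈V I)) (lo-□ (Inside.v∈V I'))
  ... | inj₁ p = ⊥-elim (InsideProperties.nothing-between I (lo-□ (Inside.v∈V I')) p (InsideProperties.d≺b I'))
  ... | inj₂ (inj₂ p) = ⊥-elim (InsideProperties.nothing-between I' (lo-□ (Inside.v∈V I)) p (InsideProperties.d≺b I))
  ... | inj₂ (inj₁ e) = third-unique J.d□ J.v∈d (subst (v' ∈□_) (sym e) (lo-∋ (Inside.v∈V I'))) J.m∈d
                          (Inside.same I) (Inside.same I') J.v≢m (InsideProperties.v≢m I')
    where module J = InsideProperties I

  outer-unique : ∀ {v m m'} → Inside v m → Inside v m' → m ≡ m'
  outer-unique I I' = third-unique J.d□ J.m∈d J'.m∈d J.v∈d (sym (Inside.same I)) (sym (Inside.same I'))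
                        (λ e → J.v≢m (sym e)) (λ e → J'.v≢m (sym e))
    where
    module J = InsideProperties I
    module J' = InsideProperties I'

  -- Every corner is nested inside its opposite vertex

  shared-side : ∀ {v c c₁} → v ∈□ c → Square V c₁ → OnlyIn V c v → c₁ ≢ c → ShareEdge c c₁ →
    ∃[ o ] (snd o c ≡ snd o c₁ × fst o c ≢ fst o c₁ ×
            ∃[ x ] (Within x (fst o c) × Within x (fst o c₁) × x ≢ fst o v))
  shared-side {v} {c} {c₁} v∈c c₁□ priv ne (p , q , p~q , pc , qc , pc₁ , qc₁)
    with Adj-axis p~q
  ... | o , fst≡ , next = o , snd≡ , (λ e → ne (point-≡ o (sym e) (sym snd≡))) ,
        fst o p , ∈□-fst o (SqPt⇒∈□ pc) , ∈□-fst o (SqPt⇒∈□ pc₁) , p≢v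
    where
    snd≡ : snd o c ≡ snd o c₁
    snd≡ = interval-unique (Next⇒≢ next) (∈□-snd o (SqPt⇒∈□ pc)) (∈□-snd o (SqPt⇒∈□ qc))
             (∈□-snd o (SqPt⇒∈□ pc₁)) (∈□-snd o (SqPt⇒∈□ qc₁))
    -- If the shared side had the coordinate of `v`, one of its ends would be `v`, which lies in no
    -- cell but `c`.
    p≢v : fst o p ≢ fst o v
    p≢v e with snd o p ℤₚ.≟ snd o v
    ... | yes e' = ne (priv c₁ c₁□ (subst (SqPt c₁) (point-≡ o e e') pc₁))
    ... | no n = ne (priv c₁ c₁□ (subst (SqPt c₁) (point-≡ o (trans (sym fst≡) e)
                   (other-unique (∈□-snd o (SqPt⇒∈□ pc)) (∈□-snd o (SqPt⇒∈□ qc)) (∈□-snd o v∈c)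
                     (λ e' → Next⇒≢ next (sym e')) (λ e' → n (sym e')))) qc₁))

  -- Of the three cells, `h` lies in `c` and `c₁` only, and `q` in `c` and `c₂` only. If `c₁` and
  -- `c₂` were on the same side of `c` in the order, the middle cell would miss a vertex common to
  -- the other two, against convexity. So `c` lies between them, and both contain `m`.
  turn⇒inside : ∀ o {v c c₁ c₂ x y} → v ∈ V → Square V c → Square V c₁ → Square V c₂ →
    v ∈□ c → OnlyIn V c v →
    snd o c ≡ snd o c₁ → fst o c ≢ fst o c₁ → Within x (fst o c) → Within x (fst o c₁) → x ≢ fst o v →
    fst o c ≡ fst o c₂ → snd o c ≢ snd o c₂ → Within y (snd o c) → Within y (snd o c₂) → y ≢ snd o v →
    ∃[ m ] Inside v m
  turn⇒inside o {v} {c} {c₁} {c₂} {x} {y} v∈V c□ c₁□ c₂□ v∈c priv s₁ f₁ xc xc₁ x≢ f₂ s₂ yc yc₂ y≢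
    = m , order (≺-cmp c₁□ c□) (≺-cmp c₂□ c□) (≺-cmp c₁□ c₂□)
    where
    m h q : Point
    m = at o x y
    h = at o x (snd o v)
    q = at o (fst o v) y
    m∈c : m ∈□ c
    m∈c = ∈□-at o {c = c} xc yc
    m∈c₁ : m ∈□ c₁
    m∈c₁ = ∈□-at o {c = c₁} xc₁ (subst (Within y) s₁ yc)
    m∈c₂ : m ∈□ c₂
    m∈c₂ = ∈□-at o {c = c₂} (subst (Within x) f₂ xc) yc₂
    m∈V : m ∈ V
    m∈V = ∈□⇒∈ c□ m∈c
    h∈c : h ∈□ c
    h∈c = ∈□-at o {c = c} xc (∈□-snd o v∈c)
    h∈c₁ : h ∈□ c₁
    h∈c₁ = ∈□-at o {c = c₁} xc₁ (subst (Within (snd o v)) s₁ (∈□-snd o v∈c))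
    h∉c₂ : ¬ h ∈□ c₂
    h∉c₂ i = s₂ (interval-unique y≢ yc (∈□-snd o v∈c) yc₂ (proj₂ (at-∈□ o {c = c₂} i)))
    q∈c : q ∈□ c
    q∈c = ∈□-at o {c = c} (∈□-fst o v∈c) yc
    q∈c₂ : q ∈□ c₂
    q∈c₂ = ∈□-at o {c = c₂} (subst (Within (fst o v)) f₂ (∈□-fst o v∈c)) yc₂
    q∉c₁ : ¬ q ∈□ c₁
    q∉c₁ i = f₁ (interval-unique x≢ xc (∈□-fst o v∈c) xc₁ (proj₁ (at-∈□ o {c = c₁} i)))
    ty : low v ≡ low m
    ty = diagonal⇒same o c□ v∈c m∈c (λ e → x≢ (trans (sym (fst-at o)) (sym e))) (λ e → y≢ (trans (sym (snd-at o)) (sym e)))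
    lo-v : lo v ≡ c
    lo-v = priv (lo v) (lo-□ v∈V) (∈□⇒SqPt (lo-∋ v∈V))
    hi-v : hi v ≡ c
    hi-v = priv (hi v) (hi-□ v∈V) (∈□⇒SqPt (hi-∋ v∈V))
    inside : ∀ {e e'} → Square V e → Square V e' → m ∈□ e → m ∈□ e' → e ≺ c → c ≺ e' → Inside v m
    inside e□ e'□ m∈e m∈e' e≺c c≺e' = record
      { v∈V = v∈V ; m∈V = m∈V ; same = ty
      ; lo≺ = subst (lo m ≺_) (sym lo-v) (lo-≺ m∈V e□ m∈e e≺c)
      ; hi≺ = subst (_≺ hi m) (sym hi-v) (≺-hi m∈V e'□ m∈e' c≺e') }
    order : c₁ ≺ c ⊎ c₁ ≡ c ⊎ c ≺ c₁ → c₂ ≺ c ⊎ c₂ ≡ c ⊎ c ≺ c₂ → c₁ ≺ c₂ ⊎ c₁ ≡ c₂ ⊎ c₂ ≺ c₁ → Inside v m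
    order (inj₂ (inj₁ e)) _ _ = ⊥-elim (f₁ (cong (fst o) (sym e)))
    order _ (inj₂ (inj₁ e)) _ = ⊥-elim (s₂ (cong (snd o) (sym e)))
    order _ _ (inj₂ (inj₁ e)) = ⊥-elim (f₁ (trans f₂ (cong (fst o) (sym e))))
    order (inj₁ p) (inj₂ (inj₂ q)) _ = inside c₁□ c₂□ m∈c₁ m∈c₂ p q
    order (inj₂ (inj₂ q)) (inj₁ p) _ = inside c₂□ c₁□ m∈c₂ m∈c₁ p q
    order (inj₁ p₁) (inj₁ p₂) (inj₁ r) = ⊥-elim (h∉c₂ (convex c₁□ c₂□ c□ r p₂ h∈c₁ h∈c))
    order (inj₁ p₁) (inj₁ p₂) (inj₂ (inj₂ r)) = ⊥-elim (q∉c₁ (convex c₂□ c₁□ c□ r p₁ q∈c₂ q∈c))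
    order (inj₂ (inj₂ p₁)) (inj₂ (inj₂ p₂)) (inj₁ r) = ⊥-elim (q∉c₁ (convex c□ c₁□ c₂□ p₁ r q∈c q∈c₂))
    order (inj₂ (inj₂ p₁)) (inj₂ (inj₂ p₂)) (inj₂ (inj₂ r)) = ⊥-elim (h∉c₂ (convex c□ c₂□ c₁□ p₂ r h∈c h∈c₁))

  corner⇒inside : ∀ {v} → v ∈ V → Corner V v → ∃[ m ] Inside v m
  corner⇒inside {v} v∈V (c , c□ , v∈c , priv , _ , c₁ , c₂ , c₁□ , c₂□ , ne₁ , ne₂ , ne₁₂ , sh₁ , sh₂)
    with shared-side (SqPt⇒∈□ v∈c) c₁□ priv ne₁ sh₁ | shared-side (SqPt⇒∈□ v∈c) c₂□ priv ne₂ sh₂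
  ... | o₁ , s₁ , f₁ , x , xc , xc₁ , x≢ | o₂ , s₂ , f₂ , y , yc , yc₂ , y≢ with frame-cases o₁ o₂
  -- Two shared sides in the same direction would both be the side of `c` away from `v`, and only
  -- one further cell contains that side.
  ...   | inj₁ refl = ⊥-elim (ne₁₂ (point-≡ o₁
            (interval-other (λ e → f₂ (sym e))
              (subst (λ k → Within k (fst o₁ c₂)) (other-unique (∈□-fst o₁ (SqPt⇒∈□ v∈c)) yc xc y≢ x≢) yc₂)
              xc₁ xc (λ e → f₁ (sym e)))
            (trans (sym s₁) s₂)))
  ...   | inj₂ f = turn⇒inside o₁ v∈V c□ c₁□ c₂□ (SqPt⇒∈□ v∈c) priv s₁ f₁ xc xc₁ x≢
            (trans (sym (proj₂ (f c))) (trans s₂ (proj₂ (f c₂))))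
            (λ e → f₂ (trans (proj₁ (f c)) (trans e (sym (proj₁ (f c₂))))))
            (subst (Within y) (proj₁ (f c)) yc) (subst (Within y) (proj₁ (f c₂)) yc₂)
            (λ e → y≢ (trans e (sym (proj₁ (f v)))))

reverse-inside : ∀ {V low} (R : Chain V low) {v m} →
  ChainProperties.Inside R v m → ChainProperties.Inside (reverse R) v m
reverse-inside R I = record { v∈V = v∈V ; m∈V = m∈V ; same = same ; lo≺ = hi≺ ; hi≺ = lo≺ }
  where open ChainProperties.Inside I

-- The order of the squares in a 12-representation

-- `Precedes` only yields decompositions of the word; with positions, several of its instances chain
-- by transitivity of `<`.
At : List ℕ → ℕ → ℕ → Set
At [] _ _ = ⊥
At (x ∷ w) zero a = x ≡ a
At (x ∷ w) (suc i) a = At w i a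

∈⇒At : ∀ {a w} → a ∈ w → ∃[ i ] At w i a
∈⇒At (here e) = 0 , sym e
∈⇒At (there a∈) = let i , p = ∈⇒At a∈ in suc i , p

At⇒∈ : ∀ {a} w i → At w i a → a ∈ w
At⇒∈ (x ∷ w) zero e = here (sym e)
At⇒∈ (x ∷ w) (suc i) p = there (At⇒∈ w i p)

At-functional : ∀ {a b} w i → At w i a → At w i b → a ≡ b
At-functional (x ∷ w) zero refl refl = refl
At-functional (x ∷ w) (suc i) p q = At-functional w i p q

Precedes⇒At : ∀ {a b w} → Precedes a b w → ∃[ i ] ∃[ j ] (i < j × At w i a × At w j b)
Precedes⇒At ([] , ys , refl , b∈) = let j , p = ∈⇒At b∈ in 0 , suc j , z<s , refl , p
Precedes⇒At (x ∷ xs , ys , refl , b∈) =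
  let i , j , i<j , p , q = Precedes⇒At (xs , ys , refl , b∈) in suc i , suc j , s<s i<j , p , q

At⇒Precedes : ∀ {a b} w {i j} → i < j → At w i a → At w j b → Precedes a b w
At⇒Precedes (x ∷ w) {zero} {suc j} _ refl q = [] , w , refl , At⇒∈ w j q
At⇒Precedes (x ∷ w) {suc i} {suc j} (s≤s i<j) p q =
  let xs , ys , e , b∈ = At⇒Precedes w i<j p q in x ∷ xs , ys , cong (x ∷_) e , b∈

occ-accept : ∀ {a x} w → x ≡ a → occ a (x ∷ w) ≡ suc (occ a w)
occ-accept w e = cong length (filter-accept (_≟ _) {xs = w} e)

occ-reject : ∀ {a x} w → x ≢ a → occ a (x ∷ w) ≡ occ a w
occ-reject w n = cong length (filter-reject (_≟ _) {xs = w} n)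

At⇒occ≢0 : ∀ {a} w i → At w i a → occ a w ≢ 0
At⇒occ≢0 {a} (x ∷ w) i p e with x ≟ a
... | yes x≡a with trans (sym (occ-accept w x≡a)) e
...   | ()
At⇒occ≢0 {a} (x ∷ w) zero p e | no n = n p
At⇒occ≢0 {a} (x ∷ w) (suc i) p e | no n = At⇒occ≢0 w i p (trans (sym (occ-reject w n)) e)

occ≡1⇒At-unique : ∀ {a} w {i j} → occ a w ≡ 1 → At w i a → At w j a → ¬ i < j
occ≡1⇒At-unique {a} (x ∷ w) {i} {suc j} e p q (s≤s i≤j) with x ≟ a
... | yes x≡a = At⇒occ≢0 w j q (ℕₚ.suc-injective (trans (sym (occ-accept w x≡a)) e))
occ≡1⇒At-unique {a} (x ∷ w) {zero} {suc j} e p q (s≤s i≤j) | no n = n p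
occ≡1⇒At-unique {a} (x ∷ w) {suc i} {suc j} e p q (s≤s i<j) | no n =
  occ≡1⇒At-unique w (trans (sym (occ-reject w n)) e) p q i<j

-- `argmin` and `argmax` need a default; taking the head makes the default a member of every
-- non-empty list.
firstOr : Point → List Point → Point
firstOr p [] = p
firstOr p (q ∷ _) = q

firstOr-∈ : ∀ {p q qs} → q ∈ qs → firstOr p qs ∈ qs
firstOr-∈ (here _) = here refl
firstOr-∈ (there _) = here refl

module Represented {V : List Point} {ℓ : Point → ℕ} {w : List ℕ}
  (sq : SquareGridGraph V) (lab : Labeling V ℓ) (rep : Represents12 V ℓ w) where

  ℓ-injective : ∀ {u v} → u ∈ V → v ∈ V → ℓ u ≡ ℓ v → u ≡ v
  ℓ-injective u∈ v∈ = proj₂ lab _ _ u∈ v∈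

  precedes : ∀ {u v} → u ∈ V → v ∈ V → ℓ u < ℓ v → ¬ Adj u v →
             ∃[ i ] ∃[ j ] (i < j × At w i (ℓ u) × At w j (ℓ v))
  precedes {u} {v} u∈ v∈ lt na = Precedes⇒At (subst₂ (λ a b → Precedes a b w)
    (ℕₚ.m≤n⇒m⊓n≡m (ℕₚ.<⇒≤ lt)) (ℕₚ.m≤n⇒m⊔n≡n (ℕₚ.<⇒≤ lt))
    (proj₁ (proj₂ (proj₂ rep) u v u∈ v∈ (λ { refl → ℕₚ.<-irrefl refl lt })) na))

  follows : ∀ {u v i j} → u ∈ V → v ∈ V → ℓ u < ℓ v → Adj u v → At w i (ℓ u) → At w j (ℓ v) → j < i
  follows {u} {v} {i} {j} u∈ v∈ lt adj p q with ℕₚ.<-cmp i j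
  ... | tri> _ _ j<i = j<i
  ... | tri≈ _ refl _ = ⊥-elim (ℕₚ.<-irrefl (At-functional w i p q) lt)
  ... | tri< i<j _ _ = ⊥-elim (proj₂ (proj₂ (proj₂ rep) u v u∈ v∈ (λ { refl → ℕₚ.<-irrefl refl lt }))
          (subst₂ (λ a b → Precedes a b w)
            (sym (ℕₚ.m≤n⇒m⊓n≡m (ℕₚ.<⇒≤ lt))) (sym (ℕₚ.m≤n⇒m⊔n≡n (ℕₚ.<⇒≤ lt)))
            (At⇒Precedes w i<j p q)) adj)

  -- The grid has no triangles, so `p` and `r` are not adjacent and some `p` precedes some `r`; but
  -- the two edges put every `r` before every `q` and every `q` before every `p`.
  no-monotone-path : ∀ {p q r} → p ∈ V → q ∈ V → r ∈ V → Adj p q → Adj q r → ℓ p < ℓ q → ¬ ℓ q < ℓ r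
  no-monotone-path {p} {q} {r} p∈ q∈ r∈ pq qr p<q q<r
    with precedes p∈ r∈ (ℕₚ.<-trans p<q q<r) (Adj-triangle {p} {q} {r} pq qr) | ∈⇒At (proj₁ (proj₂ rep) _ q∈)
  ... | i , k , i<k , ip , kr | j , jq = ℕₚ.<-asym i<k
    (ℕₚ.<-trans (follows q∈ r∈ q<r qr jq kr) (follows p∈ q∈ p<q pq ip jq))

  -- The two non-edges and the two edges would order four occurrences cyclically: x, y', x', y, and
  -- x again.
  no-crossing : ∀ {x y x' y'} → x ∈ V → y ∈ V → x' ∈ V → y' ∈ V → Adj x y → Adj x' y' →
    ¬ Adj x y' → ¬ Adj x' y → ℓ x < ℓ y → ℓ x' < ℓ y' → ℓ x < ℓ y' → ¬ ℓ x' < ℓ y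
  no-crossing x∈ y∈ x'∈ y'∈ xy x'y' xy' x'y x<y x'<y' x<y' x'<y
    with precedes x∈ y'∈ x<y' xy' | precedes x'∈ y∈ x'<y x'y
  ... | i , k , i<k , ix , ky' | j , l , j<l , jx' , ly = ℕₚ.<-asym
    (ℕₚ.<-trans i<k (follows x'∈ y'∈ x'<y' x'y' jx' ky'))
    (ℕₚ.<-trans j<l (follows x∈ y∈ x<y xy ix ly))

  Split : ℕ → Point → Point → Set
  Split k p q = (ℓ p ≤ k × k < ℓ q) ⊎ (ℓ q ≤ k × k < ℓ p)

  -- Orient both edges from the end at or below `k` to the end above it. Each lower end is then
  -- smaller than each upper end, also across the two edges, which is a crossing; the four cases are
  -- the four orientations.
  no-common-cut : ∀ {k p q p' q'} → p ∈ V → q ∈ V → p' ∈ V → q' ∈ V →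
    InducedMatching p q p' q' → Split k p q → ¬ Split k p' q'
  no-common-cut {k} {p} {q} {p'} {q'} p∈ q∈ p'∈ q'∈ (pq , p'q' , pp' , pq' , qp' , qq') = cases
    where
    _<<_ : ∀ {u v} → ℓ u ≤ k → k < ℓ v → ℓ u < ℓ v
    _<<_ = ℕₚ.≤-<-trans
    qp : Adj q p
    qp = Adj-sym {p} {q} pq
    q'p' : Adj q' p'
    q'p' = Adj-sym {p'} {q'} p'q'
    p'q : ¬ Adj p' q
    p'q z = qp' (Adj-sym {p'} {q} z)
    p'p : ¬ Adj p' p
    p'p z = pp' (Adj-sym {p'} {p} z)
    q'q : ¬ Adj q' q
    q'q z = qq' (Adj-sym {q'} {q} z)
    q'p : ¬ Adj q' p
    q'p z = pq' (Adj-sym {q'} {p} z)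
    cases : Split k p q → ¬ Split k p' q'
    cases (inj₁ (a , b)) (inj₁ (c , d)) = no-crossing p∈ q∈ p'∈ q'∈ pq p'q' pq' p'q (a << b) (c << d) (a << d) (c << b)
    cases (inj₁ (a , b)) (inj₂ (c , d)) = no-crossing p∈ q∈ q'∈ p'∈ pq q'p' pp' q'q (a << b) (c << d) (a << d) (c << b)
    cases (inj₂ (a , b)) (inj₁ (c , d)) = no-crossing q∈ p∈ p'∈ q'∈ qp p'q' qq' p'p (a << b) (c << d) (a << d) (c << b)
    cases (inj₂ (a , b)) (inj₂ (c , d)) = no-crossing q∈ p∈ q'∈ p'∈ qp q'p' qp' q'p (a << b) (c << d) (a << d) (c << b)

  Alternating : ℕ → Point → Point → Point → Point → Set
  Alternating k p q r s = ℓ p ≤ k × k < ℓ q × ℓ r ≤ k × k < ℓ s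

  -- No vertex has both a smaller and a larger neighbour, so low and high vertices alternate. Each
  -- low vertex is adjacent to both high ones, so even the larger low label is below both high
  -- labels.
  4-cycle : ∀ {p q r s} → p ∈ V → q ∈ V → r ∈ V → s ∈ V → Adj p q → Adj q r → Adj r s → Adj s p →
    ℓ p < ℓ q → Alternating ((ℓ p ⊓ ℓ q) ⊔ (ℓ r ⊓ ℓ s)) p q r s
  4-cycle {p} {q} {r} {s} p∈ q∈ r∈ s∈ pq qr rs sp p<q =
    subst (λ k → Alternating k p q r s)
      (sym (cong₂ _⊔_ (ℕₚ.m≤n⇒m⊓n≡m (ℕₚ.<⇒≤ p<q)) (ℕₚ.m≤n⇒m⊓n≡m (ℕₚ.<⇒≤ r<s))))
      (ℕₚ.m≤m⊔n _ _ , ℕₚ.⊔-lub p<q r<q , ℕₚ.m≤n⊔m _ _ , ℕₚ.⊔-lub p<s r<s)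
    where
    compare : ∀ {u v} → u ∈ V → v ∈ V → Adj u v → ¬ ℓ u < ℓ v → ℓ v < ℓ u
    compare {u} {v} u∈ v∈ uv n with ℕₚ.<-cmp (ℓ u) (ℓ v)
    ... | tri< a _ _ = ⊥-elim (n a)
    ... | tri> _ _ c = c
    ... | tri≈ _ e _ with ℓ-injective u∈ v∈ e
    ...   | refl = ⊥-elim (Adj-irrefl {u} uv)
    r<q : ℓ r < ℓ q
    r<q = compare q∈ r∈ qr (no-monotone-path p∈ q∈ r∈ pq qr p<q)
    r<s : ℓ r < ℓ s
    r<s = compare s∈ r∈ (Adj-sym {r} {s} rs) (λ s<r → no-monotone-path s∈ r∈ q∈ (Adj-sym {r} {s} rs) (Adj-sym {q} {r} qr) s<r r<q)
    p<s : ℓ p < ℓ s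
    p<s = compare s∈ p∈ sp (λ s<p → no-monotone-path s∈ p∈ q∈ sp pq s<p p<q)

  ⊓-swap : ∀ a b c d → (b ⊓ a) ⊔ (d ⊓ c) ≡ (a ⊓ b) ⊔ (c ⊓ d)
  ⊓-swap a b c d = cong₂ _⊔_ (ℕₚ.⊓-comm b a) (ℕₚ.⊓-comm d c)

  opaque
    -- Two opposite vertices of a cell carry smaller labels than the other two;
    -- κ is the larger one of these two labels.
    κ : Point → ℕ
    κ (x , y) = (ℓ (x , y) ⊓ ℓ (x + + 1 , y)) ⊔ (ℓ (x + + 1 , y + + 1) ⊓ ℓ (x , y + + 1))

    alternating : ∀ {c d} → Square V (c , d) →
      Alternating (κ (c , d)) (c , d) (c + + 1 , d) (c + + 1 , d + + 1) (c , d + + 1) ⊎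
      Alternating (κ (c , d)) (c + + 1 , d) (c , d) (c , d + + 1) (c + + 1 , d + + 1)
    alternating {c} {d} (s₀₀ , s₁₀ , s₀₁ , s₁₁) with ℕₚ.<-cmp (ℓ (c , d)) (ℓ (c + + 1 , d))
    ... | tri< lt _ _ = inj₁ (4-cycle s₀₀ s₁₀ s₁₁ s₀₁ (inj₂ (refl , inj₁ refl)) (inj₁ (refl , inj₁ refl))
                          (inj₂ (refl , inj₂ refl)) (inj₁ (refl , inj₂ refl)) lt)
    ... | tri≈ _ e _ = ⊥-elim (x≢x+1+n 0 (cong proj₁ (ℓ-injective s₀₀ s₁₀ e)))
    ... | tri> _ _ gt = inj₂ (subst (λ k → Alternating k (c + + 1 , d) (c , d) (c , d + + 1) (c + + 1 , d + + 1))
                          (⊓-swap (ℓ (c , d)) _ _ _)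
                          (4-cycle s₁₀ s₀₀ s₀₁ s₁₁ (inj₂ (refl , inj₂ refl)) (inj₁ (refl , inj₁ refl))
                          (inj₂ (refl , inj₁ refl)) (inj₁ (refl , inj₂ refl)) gt))

  vertical-split : ∀ {c d x y y'} → Square V (c , d) → Within x c → Within y d → Within y' d → y ≢ y' →
    Split (κ (c , d)) (x , y) (x , y')
  vertical-split s x∈ y∈ y'∈ ne with alternating s
  vertical-split s (inj₁ refl) (inj₁ refl) (inj₂ refl) ne | inj₁ (a , b , c , d) = inj₁ (a , d)
  vertical-split s (inj₁ refl) (inj₂ refl) (inj₁ refl) ne | inj₁ (a , b , c , d) = inj₂ (a , d)
  vertical-split s (inj₂ refl) (inj₁ refl) (inj₂ refl) ne | inj₁ (a , b , c , d) = inj₂ (c , b)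
  vertical-split s (inj₂ refl) (inj₂ refl) (inj₁ refl) ne | inj₁ (a , b , c , d) = inj₁ (c , b)
  vertical-split s (inj₁ refl) (inj₁ refl) (inj₂ refl) ne | inj₂ (a , b , c , d) = inj₂ (c , b)
  vertical-split s (inj₁ refl) (inj₂ refl) (inj₁ refl) ne | inj₂ (a , b , c , d) = inj₁ (c , b)
  vertical-split s (inj₂ refl) (inj₁ refl) (inj₂ refl) ne | inj₂ (a , b , c , d) = inj₁ (a , d)
  vertical-split s (inj₂ refl) (inj₂ refl) (inj₁ refl) ne | inj₂ (a , b , c , d) = inj₂ (a , d)
  vertical-split s _ (inj₁ refl) (inj₁ refl) ne | _ = ⊥-elim (ne refl)
  vertical-split s _ (inj₂ refl) (inj₂ refl) ne | _ = ⊥-elim (ne refl)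

  horizontal-split : ∀ {c d x x' y} → Square V (c , d) → Within x c → Within x' c → Within y d → x ≢ x' →
    Split (κ (c , d)) (x , y) (x' , y)
  horizontal-split s x∈ x'∈ y∈ ne with alternating s
  horizontal-split s (inj₁ refl) (inj₂ refl) (inj₁ refl) ne | inj₁ (a , b , c , d) = inj₁ (a , b)
  horizontal-split s (inj₁ refl) (inj₂ refl) (inj₂ refl) ne | inj₁ (a , b , c , d) = inj₂ (c , d)
  horizontal-split s (inj₂ refl) (inj₁ refl) (inj₁ refl) ne | inj₁ (a , b , c , d) = inj₂ (a , b)
  horizontal-split s (inj₂ refl) (inj₁ refl) (inj₂ refl) ne | inj₁ (a , b , c , d) = inj₁ (c , d)
  horizontal-split s (inj₁ refl) (inj₂ refl) (inj₁ refl) ne | inj₂ (a , b , c , d) = inj₂ (a , b)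
  horizontal-split s (inj₁ refl) (inj₂ refl) (inj₂ refl) ne | inj₂ (a , b , c , d) = inj₁ (c , d)
  horizontal-split s (inj₂ refl) (inj₁ refl) (inj₁ refl) ne | inj₂ (a , b , c , d) = inj₁ (a , b)
  horizontal-split s (inj₂ refl) (inj₁ refl) (inj₂ refl) ne | inj₂ (a , b , c , d) = inj₂ (c , d)
  horizontal-split s (inj₁ refl) (inj₁ refl) _ ne | _ = ⊥-elim (ne refl)
  horizontal-split s (inj₂ refl) (inj₂ refl) _ ne | _ = ⊥-elim (ne refl)

  edge-split : ∀ {c p q} → Square V c → p ∈□ c → q ∈□ c → Adj p q → Split (κ c) p q
  edge-split s (x∈ , y∈) (_ , y'∈) (inj₁ (refl , n)) = vertical-split s x∈ y∈ y'∈ (Next⇒≢ n)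
  edge-split s (x∈ , y∈) (x'∈ , _) (inj₂ (refl , n)) = horizontal-split s x∈ x'∈ y∈ (Next⇒≢ n)

  κ-injective : ∀ {c d} → Square V c → Square V d → κ c ≡ κ d → c ≡ d
  κ-injective {c} {d} c□ d□ e with Productₚ.≡-dec ℤₚ._≟_ ℤₚ._≟_ c d
  ... | yes p = p
  ... | no ne with cell-≢ ne
  ...   | v , v∈c , v∉d with separate {v} {c} {d} v∈c v∉d
  ...     | u , p , q , u∈ , p∈ , q∈ , M = ⊥-elim (no-common-cut {κ d}
              (∈□⇒∈ c□ v∈c) (∈□⇒∈ c□ u∈) (∈□⇒∈ d□ p∈) (∈□⇒∈ d□ q∈) M
              (subst (λ k → Split k v u) e (edge-split c□ v∈c u∈ (proj₁ M)))
              (edge-split d□ p∈ q∈ (proj₁ (proj₂ M))))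

  neighbour : ∀ {v c} → v ∈□ c → ∃[ u ] (u ∈□ c × Adj v u)
  neighbour {x , y} (x∈ , y∈) with other x∈
  ... | x' , x'∈ , ne = (x' , y) , (x'∈ , y∈) , inj₂ (refl , within-next x∈ x'∈ ne)

  -- Otherwise `v` would have a larger neighbour in `c` and a smaller one in `d`, which is a
  -- monotone path.
  κ-transfer : ∀ {v c d} → Square V c → Square V d → v ∈□ c → v ∈□ d → ℓ v ≤ κ c → ℓ v ≤ κ d
  κ-transfer {v} {c} {d} c□ d□ v∈c v∈d le with neighbour {v} {c} v∈c | neighbour {v} {d} v∈d
  ... | u , u∈ , vu | u' , u'∈ , vu' with edge-split c□ v∈c u∈ vu | edge-split d□ v∈d u'∈ vu'
  ... | inj₂ (_ , gt) | _ = ⊥-elim (ℕₚ.<⇒≱ gt le)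
  ... | inj₁ _ | inj₁ (le' , _) = le'
  ... | inj₁ (_ , lt) | inj₂ (le' , lt') = ⊥-elim (no-monotone-path (∈□⇒∈ d□ u'∈) (∈□⇒∈ c□ v∈c) (∈□⇒∈ c□ u∈)
          (Adj-sym {v} {u'} vu') vu (ℕₚ.≤-<-trans le' lt') (ℕₚ.≤-<-trans le lt))

  -- Use an edge at `v` in `e` if `v` is low and in `c` if it is high. One of its ends is at or
  -- below `κ c`, the other above `κ e`, so `κ d` splits it as well as the edges of `d`, whereas `v`
  -- outside `d` gives an induced matching.
  convex : ∀ {c d e v} → Square V c → Square V d → Square V e →
           κ c < κ d → κ d < κ e → v ∈□ c → v ∈□ e → v ∈□ d
  convex {c} {d} {e} {v} c□ d□ e□ c<d d<e v∈c v∈e with v ∈□? d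
  ... | yes i = i
  ... | no v∉d with ℓ v ℕₚ.≤? κ c
  ...   | yes le with separate {v} {e} {d} v∈e v∉d
  ...     | u , p , q , u∈ , p∈ , q∈ , M = ⊥-elim (no-common-cut {κ d}
              (∈□⇒∈ e□ v∈e) (∈□⇒∈ e□ u∈) (∈□⇒∈ d□ p∈) (∈□⇒∈ d□ q∈) M
              (inj₁ (ℕₚ.≤-trans le (ℕₚ.<⇒≤ c<d) , ℕₚ.<-trans d<e κ<u))
              (edge-split d□ p∈ q∈ (proj₁ (proj₂ M))))
    where
    κ<u : κ e < ℓ u
    κ<u with edge-split e□ v∈e u∈ (proj₁ M)
    ... | inj₁ (_ , lt) = lt
    ... | inj₂ (_ , lt) = ⊥-elim (ℕₚ.<⇒≱ lt (κ-transfer {v} c□ e□ v∈c v∈e le))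
  convex {c} {d} {e} {v} c□ d□ e□ c<d d<e v∈c v∈e | no v∉d | no gt with separate {v} {c} {d} v∈c v∉d
  ...     | u , p , q , u∈ , p∈ , q∈ , M = ⊥-elim (no-common-cut {κ d}
              (∈□⇒∈ c□ v∈c) (∈□⇒∈ c□ u∈) (∈□⇒∈ d□ p∈) (∈□⇒∈ d□ q∈) M
              (inj₂ (ℕₚ.≤-trans u≤κ (ℕₚ.<⇒≤ c<d) , ℕₚ.<-trans d<e κ<v))
              (edge-split d□ p∈ q∈ (proj₁ (proj₂ M))))
    where
    u≤κ : ℓ u ≤ κ c
    u≤κ with edge-split c□ v∈c u∈ (proj₁ M)
    ... | inj₁ (le , _) = ⊥-elim (gt le)
    ... | inj₂ (le , _) = le
    κ<v : κ e < ℓ v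
    κ<v with ℓ v ℕₚ.≤? κ e
    ... | yes le = ⊥-elim (gt (κ-transfer {v} e□ c□ v∈e v∈c le))
    ... | no gt' = ℕₚ.≰⇒> gt'

  opaque
    square? : ∀ c → Dec (Square V c)
    square? (x , y) = (_ ∈? V) ×-dec (_ ∈? V) ×-dec (_ ∈? V) ×-dec (_ ∈? V)

    cellsAt : Point → List Point
    cellsAt v = filter (λ c → square? c ×-dec v ∈□? c) V

    ∈-cellsAt : ∀ {v c} → Square V c → v ∈□ c → c ∈ cellsAt v
    ∈-cellsAt {v} c□ v∈ = ∈-filter⁺ (λ c → square? c ×-dec v ∈□? c) (proj₁ c□) (c□ , v∈)

    cellsAt-∈ : ∀ {v c} → c ∈ cellsAt v → Square V c × v ∈□ c
    cellsAt-∈ {v} c∈ = proj₂ (∈-filter⁻ (λ c → square? c ×-dec v ∈□? c) {xs = V} c∈)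

    lo hi : Point → Point
    lo v = argmin κ (firstOr v (cellsAt v)) (cellsAt v)
    hi v = argmax κ (firstOr v (cellsAt v)) (cellsAt v)

    firstOr-cellsAt : ∀ {v} → v ∈ V → firstOr v (cellsAt v) ∈ cellsAt v
    firstOr-cellsAt {v} v∈ with proj₁ (proj₂ sq) v v∈
    ... | c , c□ , i = firstOr-∈ (∈-cellsAt {v} c□ (SqPt⇒∈□ i))

    lo-spec : ∀ {v} → v ∈ V → Square V (lo v) × v ∈□ lo v
    lo-spec {v} v∈ with argmin-sel κ (firstOr v (cellsAt v)) (cellsAt v)
    ... | inj₁ e = cellsAt-∈ {v} (subst (_∈ cellsAt v) (sym e) (firstOr-cellsAt v∈))
    ... | inj₂ i = cellsAt-∈ {v} i

    hi-spec : ∀ {v} → v ∈ V → Square V (hi v) × v ∈□ hi v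
    hi-spec {v} v∈ with argmax-sel κ (firstOr v (cellsAt v)) (cellsAt v)
    ... | inj₁ e = cellsAt-∈ {v} (subst (_∈ cellsAt v) (sym e) (firstOr-cellsAt v∈))
    ... | inj₂ i = cellsAt-∈ {v} i

    lo-least : ∀ {v c} → Square V c → v ∈□ c → κ (lo v) ≤ κ c
    lo-least {v} c□ v∈ = All.lookup (f[argmin]≤f[xs] {f = κ} (firstOr v (cellsAt v)) (cellsAt v)) (∈-cellsAt {v} c□ v∈)

    hi-greatest : ∀ {v c} → Square V c → v ∈□ c → κ c ≤ κ (hi v)
    hi-greatest {v} c□ v∈ = All.lookup (f[xs]≤f[argmax] {f = κ} (firstOr v (cellsAt v)) (cellsAt v)) (∈-cellsAt {v} c□ v∈)

  opaque
    -- Comparison at a single cell suffices, since by `κ-transfer` the outcome is the same at all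
    -- cells of `v`.
    low : Point → Bool
    low v = ℓ v ≤ᵇ κ (lo v)

    low-true : ∀ {v c} → Square V c → v ∈□ c → ℓ v ≤ κ c → low v ≡ true
    low-true {v} c□ v∈ le with low v in e
    ... | true = refl
    ... | false = let d□ , v∈d = lo-spec (∈□⇒∈ c□ v∈) in
      ⊥-elim (subst T e (ℕₚ.≤⇒≤ᵇ (κ-transfer {v} c□ d□ v∈ v∈d le)))

    low-false : ∀ {v c} → Square V c → v ∈□ c → κ c < ℓ v → low v ≡ false
    low-false {v} c□ v∈ gt with low v in e
    ... | false = refl
    ... | true = let d□ , v∈d = lo-spec (∈□⇒∈ c□ v∈) in
      ⊥-elim (ℕₚ.<⇒≱ gt (κ-transfer {v} d□ c□ v∈d v∈ (ℕₚ.≤ᵇ⇒≤ _ _ (subst T (sym e) _))))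

  low⇒≤ : ∀ {v c} → Square V c → v ∈□ c → low v ≡ true → ℓ v ≤ κ c
  low⇒≤ {v} {c} c□ v∈ e with ℓ v ℕₚ.≤? κ c
  ... | yes le = le
  ... | no gt with trans (sym e) (low-false {v} c□ v∈ (ℕₚ.≰⇒> gt))
  ...   | ()

  high⇒> : ∀ {v c} → Square V c → v ∈□ c → low v ≡ false → κ c < ℓ v
  high⇒> {v} {c} c□ v∈ e with ℓ v ℕₚ.≤? κ c
  ... | no gt = ℕₚ.≰⇒> gt
  ... | yes le with trans (sym e) (low-true {v} c□ v∈ le)
  ...   | ()

  low-adj : ∀ {c p q} → Square V c → p ∈□ c → q ∈□ c → Adj p q → low p ≢ low q
  low-adj {c} {p} {q} c□ p∈ q∈ adj e with edge-split c□ p∈ q∈ adj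
  ... | inj₁ (a , b) with trans (sym (low-true {p} c□ p∈ a)) (trans e (low-false {q} c□ q∈ b))
  ...   | ()
  low-adj {c} {p} {q} c□ p∈ q∈ adj e | inj₂ (a , b)
    with trans (sym (low-true {q} c□ q∈ a)) (trans (sym e) (low-false {p} c□ p∈ b))
  ...   | ()

  low-diag : ∀ {c p q} → Square V c → p ∈□ c → q ∈□ c →
             proj₁ p ≢ proj₁ q → proj₂ p ≢ proj₂ q → low p ≡ low q
  low-diag {c} {p} {q} c□ p∈ q∈ ne₁ ne₂
    = two-steps (low-adj {p = p} {r} c□ p∈ r∈ pr) (low-adj {p = r} {q} c□ r∈ q∈ rq)
    where
    r : Point
    r = proj₁ p , proj₂ q
    r∈ : r ∈□ c
    r∈ = proj₁ p∈ , proj₂ q∈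
    pr : Adj p r
    pr = inj₁ (refl , within-next (proj₂ p∈) (proj₂ q∈) ne₂)
    rq : Adj r q
    rq = inj₂ (refl , within-next (proj₁ p∈) (proj₁ q∈) ne₁)
    two-steps : ∀ {a b c : Bool} → a ≢ b → b ≢ c → a ≡ c
    two-steps {false} {_} {false} _ _ = refl
    two-steps {true} {_} {true} _ _ = refl
    two-steps {false} {false} {true} p _ = ⊥-elim (p refl)
    two-steps {false} {true} {true} _ q = ⊥-elim (q refl)
    two-steps {true} {true} {false} p _ = ⊥-elim (p refl)
    two-steps {true} {false} {false} _ q = ⊥-elim (q refl)

  chain : Chain V low
  chain = record
    { _≺_ = λ c d → κ c < κ d
    ; ≺-irrefl = ℕₚ.<-irrefl refl
    ; ≺-trans = ℕₚ.<-trans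
    ; ≺-cmp = cmp
    ; convex = λ {c} {d} {e} {v} → convex {c} {d} {e} {v}
    ; lo = lo ; hi = hi
    ; lo-□ = λ v∈ → proj₁ (lo-spec v∈) ; hi-□ = λ v∈ → proj₁ (hi-spec v∈)
    ; lo-∋ = λ v∈ → proj₂ (lo-spec v∈) ; hi-∋ = λ v∈ → proj₂ (hi-spec v∈)
    ; lo-least = λ {v} c□ v∈ → ℕₚ.≤⇒≯ (lo-least {v} c□ v∈)
    ; hi-greatest = λ {v} c□ v∈ → ℕₚ.≤⇒≯ (hi-greatest {v} c□ v∈)
    ; low-adj = λ {c} {p} {q} → low-adj {c} {p} {q}
    ; low-diag = λ {c} {p} {q} → low-diag {c} {p} {q}
    }
    where
    cmp : ∀ {c d} → Square V c → Square V d → κ c < κ d ⊎ c ≡ d ⊎ κ d < κ c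
    cmp {c} {d} c□ d□ with ℕₚ.<-cmp (κ c) (κ d)
    ... | tri< lt _ _ = inj₁ lt
    ... | tri≈ _ e _ = inj₂ (inj₁ (κ-injective c□ d□ e))
    ... | tri> _ _ gt = inj₂ (inj₂ gt)

  open ChainProperties chain

  -- Corner labels repeat in every representing word

  module InsideLabels {v m : Point} (I : Inside v m) where
    open Inside I
    open InsideProperties I

    q h sa ta tb : Point
    q = at o x⁺ y
    h = at o x y⁺
    sa = at o x⁻ y
    ta = at o x⁻ y⁺
    tb = at o x⁺ y⁻
    q∈d : q ∈□ d
    q∈d = ∈□-at o {c = d} x⁺∈d y∈d
    h∈d : h ∈□ d
    h∈d = ∈□-at o {c = d} x∈d y⁺∈d
    sa∈a : sa ∈□ a
    sa∈a = ∈□-at o {c = a} x⁻∈a y∈a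
    ta∈a : ta ∈□ a
    ta∈a = ∈□-at o {c = a} x⁻∈a y⁺∈a
    tb∈b : tb ∈□ b
    tb∈b = ∈□-at o {c = b} x⁺∈b y⁻∈b
    v~q : Adj v q
    v~q = subst (λ p → Adj p q) (at-eta o v) (Adj-snd o (within-next y⁺∈d y∈d y⁺≢y))
    h~v : Adj h v
    h~v = subst (Adj h) (at-eta o v) (Adj-fst o (within-next x∈d x⁺∈d (λ e → x⁺≢x (sym e))))
    ta~sa : Adj ta sa
    ta~sa = Adj-snd o (within-next y⁺∈d y∈d y⁺≢y)
    s~tb : Adj s tb
    s~tb = Adj-fst o (within-next x∈d x⁺∈d (λ e → x⁺≢x (sym e)))
    sa~m : Adj sa m
    sa~m = subst (Adj sa) (at-eta o m) (Adj-fst o (within-next x⁻∈a x∈a (λ e → x≢x⁻ (sym e))))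
    m~s : Adj m s
    m~s = Adj-sym {s} {m} s~m
    s≁v : ¬ Adj s v
    s≁v = subst (λ p → ¬ Adj s p) (at-eta o v) (¬Adj-diagonal o (λ e → x⁺≢x (sym e)) (λ e → y⁺≢y⁻ (sym e)))
    v≁s : ¬ Adj v s
    v≁s i = s≁v (Adj-sym {v} {s} i)
    sa≁v : ¬ Adj sa v
    sa≁v = subst (λ p → ¬ Adj sa p) (at-eta o v) (¬Adj-diagonal o (λ e → x⁺≢x⁻ (sym e)) (λ e → y⁺≢y (sym e)))
    m≁v : ¬ Adj m v
    m≁v i = low-adj {d} {m} {v} d□ m∈d v∈d i (sym same)
    ta≁q : ¬ Adj ta q
    ta≁q = ¬Adj-diagonal o (λ e → x⁺≢x⁻ (sym e)) y⁺≢y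
    h≁tb : ¬ Adj h tb
    h≁tb = ¬Adj-diagonal o (λ e → x⁺≢x (sym e)) y⁺≢y⁻
    opposite : ∀ {c p r} → Square V c → p ∈□ c → r ∈□ c → Adj p r → ∀ {t} → low r ≡ t → low p ≡ not t
    opposite {c} {p} {r} c□ p∈ r∈ adj refl = Boolₚ.¬-not (low-adj {c} {p} {r} c□ p∈ r∈ adj)
    alike : ∀ {c p r} → Square V c → p ∈□ c → r ∈□ c → Adj p r → ∀ {t} → low p ≡ t → low r ≡ not t
    alike {c} {p} {r} c□ p∈ r∈ adj e = opposite {c} {r} {p} c□ r∈ p∈ (Adj-sym {p} {r} adj) e

    -- Some copy of v precedes s, which precedes m, which precedes some copy of v.
    low-occurs-twice : low v ≡ true → ∃[ i ] ∃[ j ] (i < j × At w i (ℓ v) × At w j (ℓ v))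
    low-occurs-twice v-low = twice (precedes v∈V s∈V v<s v≁s) (precedes m∈V v∈V m<v m≁v)
      where
      m-low : low m ≡ true
      m-low = trans (sym same) v-low
      κ<s : κ b < ℓ s
      κ<s = high⇒> {s} b□ s∈b (opposite {b} {s} {m} b□ s∈b m∈b s~m m-low)
      v<s : ℓ v < ℓ s
      v<s = ℕₚ.≤-<-trans (low⇒≤ {v} d□ v∈d v-low) (ℕₚ.<-trans d≺b κ<s)
      m<s : ℓ m < ℓ s
      m<s = ℕₚ.≤-<-trans (low⇒≤ {m} b□ m∈b m-low) κ<s
      κ<sa : κ a < ℓ sa
      κ<sa = high⇒> {sa} a□ sa∈a (opposite {a} {sa} {m} a□ sa∈a m∈a sa~m m-low)
      ta≤κ : ℓ ta ≤ κ a
      ta≤κ = low⇒≤ {ta} a□ ta∈a (opposite {a} {ta} {sa} a□ ta∈a sa∈a ta~sa (opposite {a} {sa} {m} a□ sa∈a m∈a sa~m m-low))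
      κ<q : κ d < ℓ q
      κ<q = high⇒> {q} d□ q∈d (alike {d} {v} {q} d□ v∈d q∈d v~q v-low)
      -- The edge from `ta` to `sa` in `a` is played against the edge from `v` to `q` in `d`. Since
      -- `ℓ ta ≤ κ a < κ d < ℓ q`, an inequality `ℓ v < ℓ sa` would complete a crossing.
      sa≤v : ℓ sa ≤ ℓ v
      sa≤v = ℕₚ.≮⇒≥ (no-crossing (∈□⇒∈ a□ ta∈a) (∈□⇒∈ a□ sa∈a) v∈V (∈□⇒∈ d□ q∈d) ta~sa v~q ta≁q
               (λ i → sa≁v (Adj-sym {v} {sa} i))
               (ℕₚ.≤-<-trans ta≤κ κ<sa)
               (ℕₚ.≤-<-trans (low⇒≤ {v} d□ v∈d v-low) κ<q)
               (ℕₚ.≤-<-trans ta≤κ (ℕₚ.<-trans a≺d κ<q)))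
      m<v : ℓ m < ℓ v
      m<v = ℕₚ.<-≤-trans (ℕₚ.≤-<-trans (low⇒≤ {m} a□ m∈a m-low) κ<sa) sa≤v
      twice : ∃[ i ] ∃[ k ] (i < k × At w i (ℓ v) × At w k (ℓ s)) →
              ∃[ i ] ∃[ j ] (i < j × At w i (ℓ m) × At w j (ℓ v)) →
              ∃[ i ] ∃[ j ] (i < j × At w i (ℓ v) × At w j (ℓ v))
      twice (i , k , i<k , iv , ks) (j , l , j<l , jm , lv) =
        i , l , ℕₚ.<-trans i<k (ℕₚ.<-trans (follows m∈V s∈V m<s m~s jm ks) j<l) , iv , lv

    -- Some copy of v precedes m, which precedes sa, which precedes some copy of v.
    high-occurs-twice : low v ≡ false → ∃[ i ] ∃[ j ] (i < j × At w i (ℓ v) × At w j (ℓ v))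
    high-occurs-twice v-high = twice (precedes v∈V m∈V v<m v≁m) (precedes sa∈V v∈V sa<v sa≁v)
      where
      sa∈V : sa ∈ V
      sa∈V = ∈□⇒∈ a□ sa∈a
      v≁m : ¬ Adj v m
      v≁m i = m≁v (Adj-sym {v} {m} i)
      m-high : low m ≡ false
      m-high = trans (sym same) v-high
      sa≤κ : ℓ sa ≤ κ a
      sa≤κ = low⇒≤ {sa} a□ sa∈a (opposite {a} {sa} {m} a□ sa∈a m∈a sa~m m-high)
      sa<v : ℓ sa < ℓ v
      sa<v = ℕₚ.≤-<-trans sa≤κ (ℕₚ.<-trans a≺d (high⇒> {v} d□ v∈d v-high))
      sa<m : ℓ sa < ℓ m
      sa<m = ℕₚ.≤-<-trans sa≤κ (high⇒> {m} a□ m∈a m-high)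
      s-low : low s ≡ true
      s-low = opposite {b} {s} {m} b□ s∈b m∈b s~m m-high
      s≤κ : ℓ s ≤ κ b
      s≤κ = low⇒≤ {s} b□ s∈b s-low
      κ<tb : κ b < ℓ tb
      κ<tb = high⇒> {tb} b□ tb∈b (alike {b} {s} {tb} b□ s∈b tb∈b s~tb s-low)
      h≤κ : ℓ h ≤ κ d
      h≤κ = low⇒≤ {h} d□ h∈d (opposite {d} {h} {v} d□ h∈d v∈d h~v v-high)
      -- Here the edge from `h` to `v` in `d` meets the edge from `s` to `tb` in `b`: as
      -- `ℓ h ≤ κ d < κ b < ℓ tb`, an inequality `ℓ s < ℓ v` would complete a crossing.
      v≤s : ℓ v ≤ ℓ s
      v≤s = ℕₚ.≮⇒≥ (no-crossing (∈□⇒∈ d□ h∈d) v∈V s∈V (∈□⇒∈ b□ tb∈b) h~v s~tb h≁tb s≁v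
              (ℕₚ.≤-<-trans h≤κ (high⇒> {v} d□ v∈d v-high))
              (ℕₚ.≤-<-trans s≤κ κ<tb)
              (ℕₚ.≤-<-trans h≤κ (ℕₚ.<-trans d≺b κ<tb)))
      v<m : ℓ v < ℓ m
      v<m = ℕₚ.≤-<-trans v≤s (ℕₚ.≤-<-trans s≤κ (high⇒> {m} b□ m∈b m-high))
      twice : ∃[ i ] ∃[ k ] (i < k × At w i (ℓ v) × At w k (ℓ m)) →
              ∃[ i ] ∃[ j ] (i < j × At w i (ℓ sa) × At w j (ℓ v)) →
              ∃[ i ] ∃[ j ] (i < j × At w i (ℓ v) × At w j (ℓ v))
      twice (i , k , i<k , iv , km) (j , l , j<l , jsa , lv) =
        i , l , ℕₚ.<-trans i<k (ℕₚ.<-trans (follows sa∈V m∈V sa<m sa~m jsa km) j<l) , iv , lv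

  corner-occurs-twice : ∀ {v} → v ∈ V → Corner V v → occ (ℓ v) w ≢ 1
  corner-occurs-twice {v} v∈ corner occ≡1 with corner⇒inside v∈ corner
  ... | m , I with low v in e
  ...   | true = let i , j , i<j , p , q = InsideLabels.low-occurs-twice I e in occ≡1⇒At-unique w occ≡1 p q i<j
  ...   | false = let i , j , i<j , p , q = InsideLabels.high-occurs-twice I e in occ≡1⇒At-unique w occ≡1 p q i<j

-- Words and sorted lists

∈⇒≤sum : ∀ {A : Set} (f : A → ℕ) {x xs} → x ∈ xs → f x ≤ sum (map f xs)
∈⇒≤sum f (here refl) = ℕₚ.m≤m+n _ _
∈⇒≤sum f {xs = y ∷ _} (there x∈) = ℕₚ.≤-trans (∈⇒≤sum f x∈) (ℕₚ.m≤n+m _ (f y))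

-- Lexicographic comparison of (p, r) and (q, r'), where r and r' stay below N.
module _ {N : ℕ} where

  opaque
    code : ℕ → ℕ → ℕ
    code p r = p * N +ℕ r

    ≤-code : ∀ p r → r ≤ code p r
    ≤-code p r = ℕₚ.m≤n+m r (p * N)

    code-<ˡ : ∀ {p q r r'} → p < q → r < N → code p r < code q r'
    code-<ˡ {p} {q} {r} {r'} p<q r<N = begin-strict
      p * N +ℕ r    <⟨ ℕₚ.+-monoʳ-< (p * N) r<N ⟩
      p * N +ℕ N    ≡⟨ ℕₚ.+-comm (p * N) N ⟩
      suc p * N     ≤⟨ ℕₚ.*-monoˡ-≤ N p<q ⟩
      q * N         ≤⟨ ℕₚ.m≤m+n (q * N) r' ⟩
      q * N +ℕ r'   ∎
      where open ℕₚ.≤-Reasoning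

    code-<ʳ : ∀ p {r r'} → r < r' → code p r < code p r'
    code-<ʳ p = ℕₚ.+-monoʳ-< (p * N)

    code-<⁻ : ∀ {p q r r'} → code p r < code q r' → r' < N → p < q ⊎ (p ≡ q × r < r')
    code-<⁻ {p} {q} lt r'<N with ℕₚ.<-cmp p q
    ... | tri< p<q _ _ = inj₁ p<q
    ... | tri≈ _ refl _ = inj₂ (refl , ℕₚ.+-cancelˡ-< (p * N) _ _ lt)
    ... | tri> _ _ q<p = ⊥-elim (ℕₚ.<-asym lt (code-<ˡ q<p r'<N))

    code-injectiveʳ : ∀ {p q r r'} → code p r ≡ code q r' → r < N → r' < N → r ≡ r'
    code-injectiveʳ {p} {q} e r<N r'<N with ℕₚ.<-cmp p q
    ... | tri< p<q _ _ = ⊥-elim (ℕₚ.<-irrefl e (code-<ˡ p<q r<N))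
    ... | tri≈ _ refl _ = ℕₚ.+-cancelˡ-≡ (p * N) _ _ e
    ... | tri> _ _ q<p = ⊥-elim (ℕₚ.<-irrefl (sym e) (code-<ˡ q<p r'<N))

opaque
  -- Doubling settles comparisons at equal values: the even code of a number comes just before its
  -- odd code, so even against odd expresses `≤` and odd against even expresses `<`.
  even odd : ℕ → ℕ
  even p = p +ℕ p
  odd p = suc (p +ℕ p)

  even<even : ∀ {p q} → p < q → even p < even q
  even<even p<q = ℕₚ.+-mono-< p<q p<q

  even<odd : ∀ {p q} → p ≤ q → even p < odd q
  even<odd p≤q = s≤s (ℕₚ.+-mono-≤ p≤q p≤q)

  odd<even : ∀ {p q} → p < q → odd p < even q
  odd<even {p} {q} p<q = subst (_≤ even q) (cong suc (ℕₚ.+-suc p p)) (ℕₚ.+-mono-≤ p<q p<q)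

  odd<odd : ∀ {p q} → p < q → odd p < odd q
  odd<odd p<q = s≤s (even<even p<q)

  even<even⁻ : ∀ {p q} → even p < even q → p < q
  even<even⁻ lt = ℕₚ.≰⇒> (λ q≤p → ℕₚ.<⇒≱ lt (ℕₚ.+-mono-≤ q≤p q≤p))

  even<odd⁻ : ∀ {p q} → even p < odd q → p ≤ q
  even<odd⁻ lt = ℕₚ.≮⇒≥ (λ q<p → ℕₚ.<-asym lt (odd<even q<p))

  odd<even⁻ : ∀ {p q} → odd p < even q → p < q
  odd<even⁻ lt = ℕₚ.≰⇒> (λ q≤p → ℕₚ.<-asym lt (even<odd q≤p))

  odd<odd⁻ : ∀ {p q} → odd p < odd q → p < q
  odd<odd⁻ (s≤s lt) = even<even⁻ lt

  even-injective : ∀ {p q} → even p ≡ even q → p ≡ q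
  even-injective e = ℕₚ.≤-antisym (ℕₚ.≮⇒≥ (λ lt → ℕₚ.<-irrefl (sym e) (even<even lt)))
                                 (ℕₚ.≮⇒≥ (λ lt → ℕₚ.<-irrefl e (even<even lt)))

  odd-injective : ∀ {p q} → odd p ≡ odd q → p ≡ q
  odd-injective e = even-injective (ℕₚ.suc-injective e)

even≢odd : ∀ {p q} → even p ≢ odd q
even≢odd {p} {q} e with ℕₚ.≤-<-connex p q
... | inj₁ p≤q = ℕₚ.<-irrefl e (even<odd p≤q)
... | inj₂ q<p = ℕₚ.<-irrefl (sym e) (odd<even q<p)

-- Order of letters in a concatenation of blocks

data Before {A : Set} (x y : A) : List A → Set where
  here : ∀ {xs} → y ∈ xs → Before x y (x ∷ xs)
  there : ∀ {z xs} → Before x y xs → Before x y (z ∷ xs)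

module _ {A : Set} where

  Before-++⁺ˡ : ∀ {x y : A} {xs} ys → Before x y xs → Before x y (xs ++ ys)
  Before-++⁺ˡ ys (here y∈) = here (∈-++⁺ˡ y∈)
  Before-++⁺ˡ ys (there b) = there (Before-++⁺ˡ ys b)

  Before-++⁺ʳ : ∀ {x y : A} xs {ys} → Before x y ys → Before x y (xs ++ ys)
  Before-++⁺ʳ [] b = b
  Before-++⁺ʳ (_ ∷ xs) b = there (Before-++⁺ʳ xs b)

  Before-++⁺ : ∀ {x y : A} {xs ys} → x ∈ xs → y ∈ ys → Before x y (xs ++ ys)
  Before-++⁺ {xs = x ∷ xs} (here refl) y∈ = here (∈-++⁺ʳ xs y∈)
  Before-++⁺ (there x∈) y∈ = there (Before-++⁺ x∈ y∈)

  Before-concatMap⁺ : ∀ {f : A → List A} {x y p q xs} → Before x y xs → p ∈ f x → q ∈ f y →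
    Before p q (concatMap f xs)
  Before-concatMap⁺ {f} (here y∈) p∈ q∈ =
    Before-++⁺ p∈ (∈-concatMap⁺ f (Any.map (λ { refl → q∈ }) y∈))
  Before-concatMap⁺ {f} (there {z} b) p∈ q∈ = Before-++⁺ʳ (f z) (Before-concatMap⁺ b p∈ q∈)

  Before-block : ∀ {f : A → List A} {x p q xs} → x ∈ xs → Before p q (f x) → Before p q (concatMap f xs)
  Before-block (here refl) b = Before-++⁺ˡ _ b
  Before-block {f} {xs = z ∷ _} (there x∈) b = Before-++⁺ʳ (f z) (Before-block x∈ b)

  Before⇒Precedes : ∀ {f : A → ℕ} {x y xs} → Before x y xs → Precedes (f x) (f y) (map f xs)
  Before⇒Precedes {f} (here y∈) = [] , _ , refl , ∈-map⁺ f y∈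
  Before⇒Precedes {f} (there {z} b) =
    let us , vs , e , i = Before⇒Precedes b in f z ∷ us , vs , cong (f z ∷_) e , i

  Precedes-AllPairs : ∀ {f : A → ℕ} {R : A → A → Set} {α β xs} → AllPairs R xs → Precedes α β (map f xs) →
    ∃[ p ] ∃[ q ] (p ∈ xs × q ∈ xs × f p ≡ α × f q ≡ β × R p q)
  Precedes-AllPairs {f} {xs = p ∷ xs} (Rp ∷ _) ([] , ys , e , β∈)
    with ∈-map⁻ f (subst (_ ∈_) (sym (∷-injectiveʳ e)) β∈)
  ... | q , q∈ , eq = p , q , here refl , there q∈ , ∷-injectiveˡ e , sym eq , All.lookup Rp q∈
  Precedes-AllPairs {f} {xs = x ∷ xs} (_ ∷ Rs) (_ ∷ us , ys , e , β∈)
    with Precedes-AllPairs Rs (us , ys , ∷-injectiveʳ e , β∈)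
  ... | p , q , p∈ , q∈ , r = p , q , there p∈ , there q∈ , r

occ-++ : ∀ a xs ys → occ a (xs ++ ys) ≡ occ a xs +ℕ occ a ys
occ-++ a xs ys = trans (cong length (filter-++ (_≟ a) xs ys)) (length-++ (filter (_≟ a) xs))

occ-∉ : ∀ {a w} → a ∉ w → occ a w ≡ 0
occ-∉ {a} a∉ = cong length (filter-none (_≟ a) (All.tabulate λ x∈ e → a∉ (subst (_∈ _) e x∈)))

occ-around : ∀ {a} xs ys zs → a ∉ xs → a ∉ zs → occ a (xs ++ (ys ++ zs)) ≡ occ a ys
occ-around {a} xs ys zs a∉xs a∉zs = begin
  occ a (xs ++ (ys ++ zs))              ≡⟨ occ-++ a xs (ys ++ zs) ⟩
  occ a xs +ℕ occ a (ys ++ zs)          ≡⟨ cong₂ _+ℕ_ (occ-∉ a∉xs) (occ-++ a ys zs) ⟩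
  occ a ys +ℕ occ a zs                  ≡⟨ cong (occ a ys +ℕ_) (occ-∉ a∉zs) ⟩
  occ a ys +ℕ 0                         ≡⟨ ℕₚ.+-identityʳ _ ⟩
  occ a ys                              ∎
  where open ≡-Reasoning

occ-singleton : ∀ a → occ a (a ∷ []) ≡ 1
occ-singleton a = occ-accept {a} [] refl

occ-pairˡ : ∀ {a b} → b ≢ a → occ a (a ∷ b ∷ []) ≡ 1
occ-pairˡ {a} {b} n = trans (occ-accept {a} (b ∷ []) refl) (cong suc (occ-reject {a} [] n))

occ-pairʳ : ∀ {a b} → b ≢ a → occ a (b ∷ a ∷ []) ≡ 1
occ-pairʳ {a} n = trans (occ-reject (a ∷ []) n) (occ-singleton a)

occ-gap : ∀ {a b c} → b ≢ a → c ≢ a → occ a (a ∷ b ∷ c ∷ a ∷ []) ≡ 2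
occ-gap {a} {b} {c} n n' = trans (occ-accept {a} (b ∷ c ∷ a ∷ []) refl)
  (cong suc (trans (occ-reject (c ∷ a ∷ []) n) (occ-pairʳ n')))

-- Strict sorting

module Sorting {A : Set} (pos : A → ℕ) where

  _⊏_ : A → A → Set
  x ⊏ y = pos x < pos y

  -- An entry whose key is already present is dropped: the list of vertices may contain repetitions,
  -- and each vertex must get only one block.
  insert : A → List A → List A
  insert x [] = x ∷ []
  insert x (y ∷ ys) with ℕₚ.<-cmp (pos x) (pos y)
  ... | tri< _ _ _ = x ∷ y ∷ ys
  ... | tri≈ _ _ _ = y ∷ ys
  ... | tri> _ _ _ = y ∷ insert x ys

  sort : List A → List A
  sort = foldr insert []

  insert-∈⁻ : ∀ {z} x ys → z ∈ insert x ys → z ∈ x ∷ ys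
  insert-∈⁻ x [] z∈ = z∈
  insert-∈⁻ x (y ∷ ys) z∈ with ℕₚ.<-cmp (pos x) (pos y)
  ... | tri< _ _ _ = z∈
  ... | tri≈ _ _ _ = there z∈
  insert-∈⁻ x (y ∷ ys) (here e) | tri> _ _ _ = there (here e)
  insert-∈⁻ x (y ∷ ys) (there z∈) | tri> _ _ _ with insert-∈⁻ x ys z∈
  ... | here e = here e
  ... | there i = there (there i)

  insert-∈⁺ : ∀ {z} x ys → z ∈ ys → z ∈ insert x ys
  insert-∈⁺ x (y ∷ ys) z∈ with ℕₚ.<-cmp (pos x) (pos y)
  ... | tri< _ _ _ = there z∈
  ... | tri≈ _ _ _ = z∈
  insert-∈⁺ x (y ∷ ys) (here e) | tri> _ _ _ = here e
  insert-∈⁺ x (y ∷ ys) (there z∈) | tri> _ _ _ = there (insert-∈⁺ x ys z∈)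

  insert-self : ∀ x ys → (∀ {y} → y ∈ ys → pos x ≡ pos y → x ≡ y) → x ∈ insert x ys
  insert-self x [] inj = here refl
  insert-self x (y ∷ ys) inj with ℕₚ.<-cmp (pos x) (pos y)
  ... | tri< _ _ _ = here refl
  ... | tri≈ _ e _ = here (inj (here refl) e)
  ... | tri> _ _ _ = there (insert-self x ys (λ y∈ → inj (there y∈)))

  insert-sorted : ∀ x ys → AllPairs _⊏_ ys → AllPairs _⊏_ (insert x ys)
  insert-sorted x [] _ = [] ∷ []
  insert-sorted x (y ∷ ys) (y⊏ ∷ s) with ℕₚ.<-cmp (pos x) (pos y)
  ... | tri< lt _ _ = (lt ∷ All.map (ℕₚ.<-trans lt) y⊏) ∷ y⊏ ∷ s
  ... | tri≈ _ _ _ = y⊏ ∷ s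
  ... | tri> _ _ gt = All.tabulate below ∷ insert-sorted x ys s
    where
    below : ∀ {z} → z ∈ insert x ys → y ⊏ z
    below z∈ with insert-∈⁻ x ys z∈
    ... | here refl = gt
    ... | there z∈ys = All.lookup y⊏ z∈ys

  sort-sorted : ∀ xs → AllPairs _⊏_ (sort xs)
  sort-sorted [] = []
  sort-sorted (x ∷ xs) = insert-sorted x (sort xs) (sort-sorted xs)

  sort-∈⁻ : ∀ {z} xs → z ∈ sort xs → z ∈ xs
  sort-∈⁻ (x ∷ xs) z∈ with insert-∈⁻ x (sort xs) z∈
  ... | here e = here e
  ... | there i = there (sort-∈⁻ xs i)

  sort-∈⁺ : ∀ {z} xs → (∀ {x y} → x ∈ xs → y ∈ xs → pos x ≡ pos y → x ≡ y) → z ∈ xs → z ∈ sort xs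
  sort-∈⁺ (x ∷ xs) inj (here refl) = insert-self x (sort xs) (λ y∈ → inj (here refl) (there (sort-∈⁻ xs y∈)))
  sort-∈⁺ (x ∷ xs) inj (there z∈) = insert-∈⁺ x (sort xs) (sort-∈⁺ xs (λ i j → inj (there i) (there j)) z∈)

  ⊏⇒Before : ∀ {x y xs} → AllPairs _⊏_ xs → x ∈ xs → y ∈ xs → x ⊏ y → Before x y xs
  ⊏⇒Before _ (here refl) (here refl) x⊏y = ⊥-elim (ℕₚ.<-irrefl refl x⊏y)
  ⊏⇒Before _ (here refl) (there y∈) _ = here y∈
  ⊏⇒Before (y⊏ ∷ _) (there x∈) (here refl) x⊏y = ⊥-elim (ℕₚ.<-asym x⊏y (All.lookup y⊏ x∈))
  ⊏⇒Before (_ ∷ s) (there x∈) (there y∈) x⊏y = there (⊏⇒Before s x∈ y∈ x⊏y)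

  split-at : ∀ {x xs} → AllPairs _⊏_ xs → x ∈ xs →
    ∃[ us ] ∃[ vs ] (xs ≡ us ++ x ∷ vs × All (_⊏ x) us × All (x ⊏_) vs × AllPairs _⊏_ vs)
  split-at (x⊏ ∷ s) (here refl) = [] , _ , refl , [] , x⊏ , s
  split-at (y⊏ ∷ s) (there x∈) =
    let us , vs , e , l , r , t = split-at s x∈ in
    _ ∷ us , vs , cong (_ ∷_) e , All.lookup y⊏ x∈ ∷ l , r , t

  head-is : ∀ {x xs} → AllPairs _⊏_ xs → x ∈ xs → (∀ {y} → y ∈ xs → ¬ y ⊏ x) →
    ∃[ ys ] (xs ≡ x ∷ ys)
  head-is _ (here refl) _ = _ , refl
  head-is (y⊏ ∷ _) (there x∈) first = ⊥-elim (first (here refl) (All.lookup y⊏ x∈))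

  -- Strictness makes `y` the head of what follows `x`, and `z` the head of what follows `y`: any
  -- other head would be a further entry between `x` and `z`. The bounds on both remainders later
  -- exclude additional copies of the letters.
  consecutive : ∀ {x y z xs} → AllPairs _⊏_ xs → x ∈ xs → y ∈ xs → z ∈ xs → x ⊏ y → y ⊏ z →
    (∀ {t} → t ∈ xs → x ⊏ t → t ⊏ z → t ≡ y) →
    ∃[ us ] ∃[ vs ] (xs ≡ us ++ x ∷ y ∷ z ∷ vs × All (_⊏ x) us × All (z ⊏_) vs)
  consecutive {x} {y} {z} {xs} s x∈ y∈ z∈ x⊏y y⊏z only with split-at s x∈
  ... | us , vs , refl , l , r , s' = finish vs r s' only' (after z∈ (ℕₚ.<-trans x⊏y y⊏z))
          (head-is s' (after y∈ x⊏y) (λ t∈ t⊏y →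
            ℕₚ.<-irrefl (cong pos (only' t∈ (ℕₚ.<-trans t⊏y y⊏z))) t⊏y))
    where
    after : ∀ {t} → t ∈ us ++ x ∷ vs → x ⊏ t → t ∈ vs
    after t∈ x⊏t = go us l t∈
      where
      go : ∀ us → All (_⊏ x) us → _ ∈ us ++ x ∷ vs → _ ∈ vs
      go [] [] (here refl) = ⊥-elim (ℕₚ.<-irrefl refl x⊏t)
      go [] [] (there i) = i
      go (_ ∷ _) (u⊏x ∷ _) (here refl) = ⊥-elim (ℕₚ.<-asym u⊏x x⊏t)
      go (_ ∷ us) (_ ∷ l) (there i) = go us l i
    only' : ∀ {t} → t ∈ vs → t ⊏ z → t ≡ y
    only' t∈ = only (∈-++⁺ʳ us (there t∈)) (All.lookup r t∈)
    finish : ∀ vs → All (x ⊏_) vs → AllPairs _⊏_ vs → (∀ {t} → t ∈ vs → t ⊏ z → t ≡ y) → z ∈ vs →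
      ∃[ ys ] (vs ≡ y ∷ ys) →
      ∃[ us' ] ∃[ vs' ] (us ++ x ∷ vs ≡ us' ++ x ∷ y ∷ z ∷ vs' × All (_⊏ x) us' × All (z ⊏_) vs')
    finish _ _ _ _ (here refl) (ys , refl) = ⊥-elim (ℕₚ.<-irrefl refl y⊏z)
    finish _ _ (y⊏ ∷ s') only' (there z∈ys) (ys , refl)
      with head-is s' z∈ys (λ t∈ t⊏z → ℕₚ.<-irrefl (cong pos (sym (only' (there t∈) t⊏z))) (All.lookup y⊏ t∈))
    finish _ _ (_ ∷ (z⊏ ∷ _)) _ (there _) (_ , refl) | zs , refl = us , zs , refl , l , z⊏

-- The new labels and the new word

module Construction {V : List Point} {ℓ : Point → ℕ} {w : List ℕ}
  (sq : SquareGridGraph V) (lab : Labeling V ℓ) (rep : Represents12 V ℓ w) where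

  open Represented sq lab rep
  open ChainProperties chain

  α β : Point → ℕ
  α v = κ (lo v)
  β v = κ (hi v)

  opaque
    -- A tie-breaker for both orders at once: it respects β where α ties and α where β ties.
    τ : Point → ℕ
    τ v = code {suc (sum (map ℓ V))} (α v +ℕ β v) (ℓ v)

    τ-< : ∀ {u v} → u ∈ V → α u +ℕ β u < α v +ℕ β v → τ u < τ v
    τ-< u∈ lt = code-<ˡ lt (s≤s (∈⇒≤sum ℓ u∈))

    τ-injective : ∀ {u v} → u ∈ V → v ∈ V → τ u ≡ τ v → u ≡ v
    τ-injective u∈ v∈ e = ℓ-injective u∈ v∈ (code-injectiveʳ e (s≤s (∈⇒≤sum ℓ u∈)) (s≤s (∈⇒≤sum ℓ v∈)))

    τ-positive : ∀ {v} → v ∈ V → 0 < τ v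
    τ-positive {v} v∈ = ℕₚ.≤-trans (proj₁ lab _ v∈) (≤-code (α v +ℕ β v) (ℓ v))

    N : ℕ
    N = suc (sum (map τ V))

    τ<N : ∀ {v} → v ∈ V → τ v < N
    τ<N v∈ = s≤s (∈⇒≤sum τ v∈)

  τ-<⇒≤ˡ : ∀ {u v} → v ∈ V → τ u < τ v → α u ≡ α v → β u ≤ β v
  τ-<⇒≤ˡ {u} v∈ lt e = ℕₚ.≮⇒≥ (λ gt → ℕₚ.<-asym lt (τ-< v∈ (ℕₚ.+-mono-≤-< (ℕₚ.≤-reflexive (sym e)) gt)))

  τ-<⇒≤ʳ : ∀ {u v} → v ∈ V → τ u < τ v → β u ≡ β v → α u ≤ α v
  τ-<⇒≤ʳ v∈ lt e = ℕₚ.≮⇒≥ (λ gt → ℕₚ.<-asym lt (τ-< v∈ (ℕₚ.+-mono-<-≤ gt (ℕₚ.≤-reflexive (sym e)))))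

  opaque
    -- Let u be low and v high. By parity, u has the smaller label exactly if `α u ≤ β v`, and v has
    -- the smaller position exactly if `α v ≤ β u`. Together these say that the intervals meet, so
    -- the edges are the inversions between the classes.
    labelIn posIn : Bool → Point → ℕ
    labelIn true v = code {N} (even (α v)) (τ v)
    labelIn false v = code {N} (odd (β v)) (τ v)
    posIn true v = code {N} (odd (β v)) (τ v)
    posIn false v = code {N} (even (α v)) (τ v)

  label pos : Point → ℕ
  label v = labelIn (low v) v
  pos v = posIn (low v) v

  opaque
    unfolding labelIn

    label-positive : ∀ v → v ∈ V → 0 < label v
    label-positive v v∈ with low v
    ... | true = ℕₚ.≤-trans (τ-positive v∈) (≤-code (even (α v)) (τ v))
    ... | false = ℕₚ.≤-trans (τ-positive v∈) (≤-code (odd (β v)) (τ v))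

    label-injective : ∀ u v → u ∈ V → v ∈ V → label u ≡ label v → u ≡ v
    label-injective u v u∈ v∈ e with low u | low v
    ... | true | true = τ-injective u∈ v∈ (code-injectiveʳ e (τ<N u∈) (τ<N v∈))
    ... | true | false = τ-injective u∈ v∈ (code-injectiveʳ e (τ<N u∈) (τ<N v∈))
    ... | false | true = τ-injective u∈ v∈ (code-injectiveʳ e (τ<N u∈) (τ<N v∈))
    ... | false | false = τ-injective u∈ v∈ (code-injectiveʳ e (τ<N u∈) (τ<N v∈))

    pos-injective : ∀ {u v} → u ∈ V → v ∈ V → pos u ≡ pos v → u ≡ v
    pos-injective {u} {v} u∈ v∈ e with low u | low v
    ... | true | true = τ-injective u∈ v∈ (code-injectiveʳ e (τ<N u∈) (τ<N v∈))
    ... | true | false = τ-injective u∈ v∈ (code-injectiveʳ e (τ<N u∈) (τ<N v∈))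
    ... | false | true = τ-injective u∈ v∈ (code-injectiveʳ e (τ<N u∈) (τ<N v∈))
    ... | false | false = τ-injective u∈ v∈ (code-injectiveʳ e (τ<N u∈) (τ<N v∈))

    label-low-low⁻ : ∀ {u v} → v ∈ V → labelIn true u < labelIn true v → α u < α v ⊎ (α u ≡ α v × τ u < τ v)
    label-low-low⁻ v∈ lt with code-<⁻ lt (τ<N v∈)
    ... | inj₁ p = inj₁ (even<even⁻ p)
    ... | inj₂ (e , p) = inj₂ (even-injective e , p)

    label-high-high⁻ : ∀ {u v} → v ∈ V → labelIn false u < labelIn false v → β u < β v ⊎ (β u ≡ β v × τ u < τ v)
    label-high-high⁻ v∈ lt with code-<⁻ lt (τ<N v∈)
    ... | inj₁ p = inj₁ (odd<odd⁻ p)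
    ... | inj₂ (e , p) = inj₂ (odd-injective e , p)

    label-low-high⁻ : ∀ {u v} → v ∈ V → labelIn true u < labelIn false v → α u ≤ β v
    label-low-high⁻ v∈ lt with code-<⁻ lt (τ<N v∈)
    ... | inj₁ p = even<odd⁻ p
    ... | inj₂ (e , _) = ⊥-elim (even≢odd e)

    label-high-low⁻ : ∀ {u v} → v ∈ V → labelIn false u < labelIn true v → β u < α v
    label-high-low⁻ v∈ lt with code-<⁻ lt (τ<N v∈)
    ... | inj₁ p = odd<even⁻ p
    ... | inj₂ (e , _) = ⊥-elim (even≢odd (sym e))

    pos-low-low : ∀ {u v} → u ∈ V → β u < β v ⊎ (β u ≡ β v × τ u < τ v) → posIn true u < posIn true v
    pos-low-low u∈ (inj₁ lt) = code-<ˡ (odd<odd lt) (τ<N u∈)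
    pos-low-low {u} {v} u∈ (inj₂ (e , lt)) =
      subst (λ k → posIn true u < code {N} (odd k) (τ v)) e (code-<ʳ _ lt)

    pos-high-high : ∀ {u v} → u ∈ V → α u < α v ⊎ (α u ≡ α v × τ u < τ v) → posIn false u < posIn false v
    pos-high-high u∈ (inj₁ lt) = code-<ˡ (even<even lt) (τ<N u∈)
    pos-high-high {u} {v} u∈ (inj₂ (e , lt)) =
      subst (λ k → posIn false u < code {N} (even k) (τ v)) e (code-<ʳ _ lt)

    pos-low-high : ∀ {u v} → u ∈ V → β u < α v → posIn true u < posIn false v
    pos-low-high u∈ lt = code-<ˡ (odd<even lt) (τ<N u∈)

    pos-high-low : ∀ {u v} → u ∈ V → α u ≤ β v → posIn false u < posIn true v
    pos-high-low u∈ le = code-<ˡ (even<odd le) (τ<N u∈)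

    pos-low-low⁻ : ∀ {u v} → v ∈ V → posIn true u < posIn true v → β u < β v ⊎ (β u ≡ β v × τ u < τ v)
    pos-low-low⁻ v∈ lt with code-<⁻ lt (τ<N v∈)
    ... | inj₁ p = inj₁ (odd<odd⁻ p)
    ... | inj₂ (e , p) = inj₂ (odd-injective e , p)

    pos-high-high⁻ : ∀ {u v} → v ∈ V → posIn false u < posIn false v → α u < α v ⊎ (α u ≡ α v × τ u < τ v)
    pos-high-high⁻ v∈ lt with code-<⁻ lt (τ<N v∈)
    ... | inj₁ p = inj₁ (even<even⁻ p)
    ... | inj₂ (e , p) = inj₂ (even-injective e , p)

    pos-high-low⁻ : ∀ {u v} → v ∈ V → posIn false u < posIn true v → α u ≤ β v
    pos-high-low⁻ v∈ lt with code-<⁻ lt (τ<N v∈)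
    ... | inj₁ p = even<odd⁻ p
    ... | inj₂ (e , _) = ⊥-elim (even≢odd e)

    pos-low-high⁻ : ∀ {u v} → v ∈ V → posIn true u < posIn false v → β u < α v
    pos-low-high⁻ v∈ lt with code-<⁻ lt (τ<N v∈)
    ... | inj₁ p = odd<even⁻ p
    ... | inj₂ (e , _) = ⊥-elim (even≢odd (sym e))

  labelling : Labeling V label
  labelling = label-positive , label-injective

  α≤β : ∀ {v} → v ∈ V → α v ≤ β v
  α≤β {v} v∈ = let c□ , v∈c = hi-spec v∈ in lo-least {v} c□ v∈c

  common-cell⇒meet : ∀ {u v c} → Square V c → u ∈□ c → v ∈□ c → α u ≤ β v
  common-cell⇒meet {u} {v} c□ u∈ v∈ = ℕₚ.≤-trans (lo-least {u} c□ u∈) (hi-greatest {v} c□ v∈)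

  Adj⇒meet : ∀ {u v} → u ∈ V → v ∈ V → Adj u v → α u ≤ β v
  Adj⇒meet {u} {v} u∈ v∈ adj with proj₂ (proj₂ sq) u v u∈ v∈ adj
  ... | c , c□ , u∈c , v∈c = common-cell⇒meet {u} {v} c□ (SqPt⇒∈□ u∈c) (SqPt⇒∈□ v∈c)

  Adj⇒low≢ : ∀ {u v} → u ∈ V → v ∈ V → Adj u v → low u ≢ low v
  Adj⇒low≢ {u} {v} u∈ v∈ adj with proj₂ (proj₂ sq) u v u∈ v∈ adj
  ... | c , c□ , u∈c , v∈c = low-adj {c} {u} {v} c□ (SqPt⇒∈□ u∈c) (SqPt⇒∈□ v∈c) adj

  low≢⇒Adj : ∀ {c u v} → Square V c → u ∈□ c → v ∈□ c → low u ≢ low v → Adj u v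
  low≢⇒Adj {c} {u} {v} c□ u∈ v∈ ne with proj₁ u ℤₚ.≟ proj₁ v | proj₂ u ℤₚ.≟ proj₂ v
  ... | no n | no n' = ⊥-elim (ne (low-diag {c} {u} {v} c□ u∈ v∈ n n'))
  ... | yes e | no n = inj₁ (e , within-next (proj₂ u∈) (proj₂ v∈) n)
  ... | no n | yes e = inj₂ (e , within-next (proj₁ u∈) (proj₁ v∈) n)
  ... | yes e | yes e' = ⊥-elim (ne (cong low (point-≡ false e e')))

  between-extremes : ∀ {v c} → v ∈ V → Square V c → α v ≤ κ c → κ c ≤ β v → v ∈□ c
  between-extremes {v} {c} v∈ c□ le le' with ℕₚ.m≤n⇒m<n∨m≡n le | ℕₚ.m≤n⇒m<n∨m≡n le'
  ... | inj₂ e | _ = subst (v ∈□_) (κ-injective (proj₁ (lo-spec v∈)) c□ e) (proj₂ (lo-spec v∈))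
  ... | _ | inj₂ e = subst (v ∈□_) (sym (κ-injective c□ (proj₁ (hi-spec v∈)) e)) (proj₂ (hi-spec v∈))
  ... | inj₁ lt | inj₁ lt' = convex {lo v} {c} {hi v} {v} (proj₁ (lo-spec v∈)) c□ (proj₁ (hi-spec v∈)) lt lt'
                               (proj₂ (lo-spec v∈)) (proj₂ (hi-spec v∈))

  -- The larger of the two left ends belongs to both intervals, and in the corresponding common cell
  -- vertices of different classes are adjacent.
  meet⇒Adj : ∀ {u v} → u ∈ V → v ∈ V → low u ≢ low v → α u ≤ β v → α v ≤ β u → Adj u v
  meet⇒Adj {u} {v} u∈ v∈ ne le le' with ℕₚ.≤-total (α u) (α v)
  ... | inj₁ p = low≢⇒Adj {lo v} {u} {v} (proj₁ (lo-spec v∈))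
                   (between-extremes {u} u∈ (proj₁ (lo-spec v∈)) p le') (proj₂ (lo-spec v∈)) ne
  ... | inj₂ p = low≢⇒Adj {lo u} {u} {v} (proj₁ (lo-spec u∈)) (proj₂ (lo-spec u∈))
                   (between-extremes {v} v∈ (proj₁ (lo-spec u∈)) p le) ne

  -- Blocks carrying the second copies

  inside? : ∀ m v → Dec (low v ≡ low m × α m < α v × β v < β m)
  inside? m v = (low v Boolₚ.≟ low m) ×-dec (α m ℕₚ.<? α v) ×-dec (β v ℕₚ.<? β m)

  -- For low `m` the label of `m` is the smaller one although `v` is sorted before `m`, so a copy of
  -- `v` is needed after `m`. For high `m` both relations are reversed and the copy goes before `m`.
  -- The list of candidates may repeat its vertex, but by `inner-unique` all entries agree, so the
  -- head suffices.
  place : Bool → Point → List Point → List Point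
  place _ m [] = m ∷ []
  place true m (v ∷ _) = m ∷ v ∷ []
  place false m (v ∷ _) = v ∷ m ∷ []

  data Block (m : Point) : List Point → Set where
    plain : (∀ {v} → ¬ Inside v m) → Block m (m ∷ [])
    after : ∀ {v} → low m ≡ true → Inside v m → Block m (m ∷ v ∷ [])
    before : ∀ {v} → low m ≡ false → Inside v m → Block m (v ∷ m ∷ [])

  opaque
    block : Point → List Point
    block m = place (low m) m (filter (inside? m) V)

    block-view : ∀ {m} → m ∈ V → Block m (block m)
    block-view {m} m∈ with filter (inside? m) V in e
    ... | [] = plain (λ {v} I → none e (∈-filter⁺ (inside? m) (Inside.v∈V I) (Inside.same I , Inside.lo≺ I , Inside.hi≺ I)))
      where
      none : ∀ {v : Point} {xs} → xs ≡ [] → v ∈ xs → ⊥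
      none refl ()
    ... | v ∷ _ with ∈-filter⁻ (inside? m) {v} {V} (subst (v ∈_) (sym e) (here refl)) | low m in c
    ...   | v∈ , t , p , q | true = after c (record { v∈V = v∈ ; m∈V = m∈ ; same = t ; lo≺ = p ; hi≺ = q })
    ...   | v∈ , t , p , q | false = before c (record { v∈V = v∈ ; m∈V = m∈ ; same = t ; lo≺ = p ; hi≺ = q })

  block-self : ∀ {m} → m ∈ V → m ∈ block m
  block-self {m} m∈ with block m | block-view m∈
  ... | _ | plain _ = here refl
  ... | _ | after _ _ = here refl
  ... | _ | before _ _ = there (here refl)

  block-∈ : ∀ {m p} → m ∈ V → p ∈ block m → p ≡ m ⊎ Inside p m
  block-∈ {m} m∈ p∈ with block m | block-view m∈
  block-∈ m∈ (here e) | _ | plain _ = inj₁ e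
  block-∈ m∈ (here e) | _ | after _ _ = inj₁ e
  block-∈ m∈ (there (here refl)) | _ | after _ I = inj₂ I
  block-∈ m∈ (here refl) | _ | before _ I = inj₂ I
  block-∈ m∈ (there (here e)) | _ | before _ _ = inj₁ e

  block-plain : ∀ {m} → m ∈ V → (∀ {v} → ¬ Inside v m) → block m ≡ m ∷ []
  block-plain {m} m∈ none with block m | block-view m∈
  ... | _ | plain _ = refl
  ... | _ | after _ I = ⊥-elim (none I)
  ... | _ | before _ I = ⊥-elim (none I)

  block-after : ∀ {v m} → Inside v m → low m ≡ true → block m ≡ m ∷ v ∷ []
  block-after {v} {m} I e with block m | block-view (Inside.m∈V I)
  ... | _ | plain n = ⊥-elim (n I)
  ... | _ | after _ I' = cong (λ k → _ ∷ k ∷ []) (inner-unique I' I)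
  ... | _ | before e' _ with trans (sym e) e'
  ...   | ()

  block-before : ∀ {v m} → Inside v m → low m ≡ false → block m ≡ v ∷ m ∷ []
  block-before {v} {m} I e with block m | block-view (Inside.m∈V I)
  ... | _ | plain n = ⊥-elim (n I)
  ... | _ | before _ I' = cong (λ k → k ∷ _ ∷ []) (inner-unique I' I)
  ... | _ | after e' _ with trans (sym e) e'
  ...   | ()

  open Sorting pos

  order : List Point
  order = sort V

  order-sorted : AllPairs _⊏_ order
  order-sorted = sort-sorted V

  ∈-order : ∀ {v} → v ∈ V → v ∈ order
  ∈-order = sort-∈⁺ V pos-injective

  order-∈ : ∀ {v} → v ∈ order → v ∈ V
  order-∈ = sort-∈⁻ V

  word : List ℕ
  word = map label (concatMap block order)

  inside-pos-low : ∀ {v m} → Inside v m → low m ≡ true → v ⊏ m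
  inside-pos-low {v} {m} I e rewrite Inside.same I | e = pos-low-low {v} {m} (Inside.v∈V I) (inj₁ (Inside.hi≺ I))

  inside-pos-high : ∀ {v m} → Inside v m → low m ≡ false → m ⊏ v
  inside-pos-high {v} {m} I e rewrite Inside.same I | e = pos-high-high {m} {v} (Inside.m∈V I) (inj₁ (Inside.lo≺ I))

  word⇒vertex : ∀ {a} → a ∈ word → ∃[ v ] (v ∈ V × label v ≡ a)
  word⇒vertex a∈ with ∈-map⁻ label a∈
  ... | p , p∈ , refl with find (∈-concatMap⁻ block {xs = order} p∈)
  ... | t , t∈ , p∈t with block-∈ (order-∈ t∈) p∈t
  ... | inj₁ refl = p , order-∈ t∈ , refl
  ... | inj₂ I = p , Inside.v∈V I , refl

  vertex⇒word : ∀ {v} → v ∈ V → label v ∈ word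
  vertex⇒word v∈ = ∈-map⁺ label (∈-concatMap⁺ block (Any.map (λ { refl → block-self v∈ }) (∈-order v∈)))

  -- The invariant that protects edges from the second copies. An edge can only be destroyed by a
  -- low letter standing before a high one, and second copies move low letters later and high
  -- letters earlier than their own positions.
  Ordered : Point → Point → Set
  Ordered p q = p ∈ V × q ∈ V × (low p ≡ true → low q ≡ false → pos p ≤ pos q)

  block-ordered : ∀ {t t' p q} → t ∈ V → t' ∈ V → pos t ≤ pos t' → p ∈ block t → q ∈ block t' → Ordered p q
  block-ordered {t} {t'} {p} {q} t∈ t'∈ le p∈ q∈ with block-∈ t∈ p∈ | block-∈ t'∈ q∈
  ... | P | Q = member t∈ P , member t'∈ Q , λ pl qh → ℕₚ.≤-trans (low-first P pl) (ℕₚ.≤-trans le (high-last Q qh))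
    where
    member : ∀ {t p} → t ∈ V → p ≡ t ⊎ Inside p t → p ∈ V
    member t∈ (inj₁ refl) = t∈
    member t∈ (inj₂ I) = Inside.v∈V I
    low-first : ∀ {t p} → p ≡ t ⊎ Inside p t → low p ≡ true → pos p ≤ pos t
    low-first (inj₁ refl) _ = ℕₚ.≤-refl
    low-first (inj₂ I) e = ℕₚ.<⇒≤ (inside-pos-low I (trans (sym (Inside.same I)) e))
    high-last : ∀ {t p} → p ≡ t ⊎ Inside p t → low p ≡ false → pos t ≤ pos p
    high-last (inj₁ refl) _ = ℕₚ.≤-refl
    high-last (inj₂ I) e = ℕₚ.<⇒≤ (inside-pos-high I (trans (sym (Inside.same I)) e))

  all-pairs : ∀ {A : Set} {R : A → A → Set} xs → (∀ {x y} → x ∈ xs → y ∈ xs → R x y) → AllPairs R xs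
  all-pairs [] f = []
  all-pairs (x ∷ xs) f = All.tabulate (λ y∈ → f (here refl) (there y∈)) ∷ all-pairs xs (λ x∈ y∈ → f (there x∈) (there y∈))

  blocks-ordered : ∀ {ts} → All (_∈ V) ts → AllPairs _⊏_ ts → AllPairs Ordered (concatMap block ts)
  blocks-ordered [] [] = []
  blocks-ordered {t ∷ ts} (t∈ ∷ ts∈) (t⊏ ∷ s) = AllPairsₚ.++⁺
    (all-pairs (block t) (block-ordered t∈ t∈ ℕₚ.≤-refl))
    (blocks-ordered ts∈ s)
    (All.tabulate λ p∈ → All.tabulate λ q∈ → across p∈ (find (∈-concatMap⁻ block {xs = ts} q∈)))
    where
    across : ∀ {p q} → p ∈ block t → ∃[ t' ] (t' ∈ ts × q ∈ block t') → Ordered p q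
    across p∈ (t' , t'∈ , q∈) = block-ordered t∈ (All.lookup ts∈ t'∈) (ℕₚ.<⇒≤ (All.lookup t⊏ t'∈)) p∈ q∈

  Precedes⇒pos : ∀ {u v} → u ∈ V → v ∈ V → low u ≡ true → low v ≡ false →
    Precedes (label u) (label v) word → pos u ≤ pos v
  Precedes⇒pos {u} {v} u∈ v∈ ul vh prec
    with Precedes-AllPairs (blocks-ordered (All.tabulate order-∈) order-sorted) prec
  ... | p , q , _ , _ , e , e' , p∈ , q∈ , f with label-injective p u p∈ u∈ e | label-injective q v q∈ v∈ e'
  ... | refl | refl = f ul vh

  pos⇒Precedes : ∀ {u v} → u ∈ V → v ∈ V → pos u < pos v → Precedes (label u) (label v) word
  pos⇒Precedes u∈ v∈ lt = Before⇒Precedes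
    (Before-concatMap⁺ (⊏⇒Before order-sorted (∈-order u∈) (∈-order v∈) lt) (block-self u∈) (block-self v∈))

  block⇒Precedes : ∀ {m p q} → m ∈ V → block m ≡ p ∷ q ∷ [] → Precedes (label p) (label q) word
  block⇒Precedes {m} {p} {q} m∈ e = Before⇒Precedes (Before-block (∈-order m∈) (subst (Before p q) (sym e) (here (here refl))))

  nonadjacent⇒Precedes : ∀ {u v} → u ∈ V → v ∈ V → label u < label v → ¬ Adj u v → Precedes (label u) (label v) word
  nonadjacent⇒Precedes {u} {v} u∈ v∈ lt na = by-class (low u) (low v) refl refl lt
    where
    by-class : ∀ s t → low u ≡ s → low v ≡ t → labelIn s u < labelIn t v → Precedes (label u) (label v) word
    by-class true false cu cv lt = pos⇒Precedes u∈ v∈ (subst₂ (λ s t → posIn s u < posIn t v) (sym cu) (sym cv) (pos-low-high {u} {v} u∈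
          (ℕₚ.≰⇒> (λ le → na (meet⇒Adj {u} {v} u∈ v∈ differ (label-low-high⁻ {u} {v} v∈ lt) le)))))
      where
      differ : low u ≢ low v
      differ e with trans (sym cu) (trans e cv)
      ... | ()
    by-class false true cu cv lt = pos⇒Precedes u∈ v∈ (subst₂ (λ s t → posIn s u < posIn t v) (sym cu) (sym cv) (pos-high-low {u} {v} u∈
          (ℕₚ.≤-trans (α≤β u∈) (ℕₚ.≤-trans (ℕₚ.<⇒≤ (label-high-low⁻ {u} {v} v∈ lt)) (α≤β v∈)))))
    by-class true true cu cv lt = cases (label-low-low⁻ {u} {v} v∈ lt)
      where
      via-pos : β u < β v ⊎ (β u ≡ β v × τ u < τ v) → Precedes (label u) (label v) word
      via-pos p = pos⇒Precedes u∈ v∈ (subst₂ (λ s t → posIn s u < posIn t v) (sym cu) (sym cv) (pos-low-low {u} {v} u∈ p))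
      cases : α u < α v ⊎ (α u ≡ α v × τ u < τ v) → Precedes (label u) (label v) word
      cases (inj₂ (e , t)) with ℕₚ.m≤n⇒m<n∨m≡n (τ-<⇒≤ˡ {u} {v} v∈ t e)
      ... | inj₁ p = via-pos (inj₁ p)
      ... | inj₂ p = via-pos (inj₂ (p , t))
      cases (inj₁ a) with ℕₚ.<-cmp (β u) (β v)
      ... | tri< p _ _ = via-pos (inj₁ p)
      ... | tri≈ _ p _ = via-pos (inj₂ (p , τ-< u∈ (ℕₚ.+-mono-<-≤ a (ℕₚ.≤-reflexive p))))
      -- The sorted order has these two the wrong way round; the second letter in the block of `u`
      -- supplies the missing occurrence.
      ... | tri> _ _ p = block⇒Precedes u∈ (block-after
            (record { v∈V = v∈ ; m∈V = u∈ ; same = trans cv (sym cu) ; lo≺ = a ; hi≺ = p }) cu)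
    by-class false false cu cv lt = cases (label-high-high⁻ {u} {v} v∈ lt)
      where
      via-pos : α u < α v ⊎ (α u ≡ α v × τ u < τ v) → Precedes (label u) (label v) word
      via-pos p = pos⇒Precedes u∈ v∈ (subst₂ (λ s t → posIn s u < posIn t v) (sym cu) (sym cv) (pos-high-high {u} {v} u∈ p))
      cases : β u < β v ⊎ (β u ≡ β v × τ u < τ v) → Precedes (label u) (label v) word
      cases (inj₂ (e , t)) with ℕₚ.m≤n⇒m<n∨m≡n (τ-<⇒≤ʳ {u} {v} v∈ t e)
      ... | inj₁ p = via-pos (inj₁ p)
      ... | inj₂ p = via-pos (inj₂ (p , t))
      cases (inj₁ b) with ℕₚ.<-cmp (α u) (α v)
      ... | tri< p _ _ = via-pos (inj₁ p)
      ... | tri≈ _ p _ = via-pos (inj₂ (p , τ-< u∈ (ℕₚ.+-mono-≤-< (ℕₚ.≤-reflexive p) b)))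
      ... | tri> _ _ p = block⇒Precedes v∈ (block-before
            (record { v∈V = u∈ ; m∈V = v∈ ; same = trans cu (sym cv) ; lo≺ = p ; hi≺ = b }) cv)

  -- Adjacent vertices have meeting intervals. This contradicts a high label below a low one
  -- outright; for a low label below a high one it sorts the high vertex strictly first, which
  -- `Ordered` preserves in the word.
  Precedes⇒nonadjacent : ∀ {u v} → u ∈ V → v ∈ V → label u < label v → Precedes (label u) (label v) word → ¬ Adj u v
  Precedes⇒nonadjacent {u} {v} u∈ v∈ lt prec adj = by-class (low u) (low v) refl refl lt
    where
    meet : α v ≤ β u
    meet = Adj⇒meet {v} {u} v∈ u∈ (Adj-sym {u} {v} adj)
    by-class : ∀ s t → low u ≡ s → low v ≡ t → labelIn s u < labelIn t v → ⊥
    by-class true true cu cv lt = Adj⇒low≢ {u} {v} u∈ v∈ adj (trans cu (sym cv))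
    by-class false false cu cv lt = Adj⇒low≢ {u} {v} u∈ v∈ adj (trans cu (sym cv))
    by-class false true cu cv lt = ℕₚ.<⇒≱ (label-high-low⁻ {u} {v} v∈ lt) meet
    by-class true false cu cv lt = ℕₚ.<⇒≱
      (subst₂ (λ s t → posIn s v < posIn t u) (sym cv) (sym cu) (pos-high-low {v} {u} v∈ meet))
      (Precedes⇒pos u∈ v∈ cu cv prec)

  represents : Represents12 V label word
  represents = (λ a → word⇒vertex) , (λ v → vertex⇒word) , λ u v u∈ v∈ u≢v → compare u∈ v∈ u≢v
    where
    compare : ∀ {u v} → u ∈ V → v ∈ V → u ≢ v →
      (¬ Adj u v → Precedes (label u ⊓ label v) (label u ⊔ label v) word) ×
      (Precedes (label u ⊓ label v) (label u ⊔ label v) word → ¬ Adj u v)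
    compare {u} {v} u∈ v∈ u≢v with ℕₚ.<-cmp (label u) (label v)
    ... | tri≈ _ e _ = ⊥-elim (u≢v (label-injective u v u∈ v∈ e))
    ... | tri< lt _ _ = subst₂ (λ i j → (¬ Adj u v → Precedes i j word) × (Precedes i j word → ¬ Adj u v))
            (sym (ℕₚ.m≤n⇒m⊓n≡m (ℕₚ.<⇒≤ lt))) (sym (ℕₚ.m≤n⇒m⊔n≡n (ℕₚ.<⇒≤ lt)))
            (nonadjacent⇒Precedes u∈ v∈ lt , Precedes⇒nonadjacent u∈ v∈ lt)
    ... | tri> _ _ gt = subst₂ (λ i j → (¬ Adj u v → Precedes i j word) × (Precedes i j word → ¬ Adj u v))
            (sym (ℕₚ.m≥n⇒m⊓n≡n (ℕₚ.<⇒≤ gt))) (sym (ℕₚ.m≥n⇒m⊔n≡m (ℕₚ.<⇒≤ gt)))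
            ((λ na → nonadjacent⇒Precedes v∈ u∈ gt (λ adj → na (Adj-sym {v} {u} adj))) ,
             (λ p adj → Precedes⇒nonadjacent v∈ u∈ gt p (Adj-sym {u} {v} adj)))

  -- Counting the occurrences of a label

  label-∉ : ∀ {v ts} → v ∈ V → All (_∈ V) ts → All (λ t → t ≢ v × ¬ Inside v t) ts →
    label v ∉ map label (concatMap block ts)
  label-∉ {v} {ts} v∈ ts∈ away i with ∈-map⁻ label i
  ... | p , p∈ , e with find (∈-concatMap⁻ block {xs = ts} p∈)
  ... | t , t∈ , p∈t with block-∈ (All.lookup ts∈ t∈) p∈t
  ... | inj₁ refl = proj₁ (All.lookup away t∈) (label-injective t v (All.lookup ts∈ t∈) v∈ (sym e))
  ... | inj₂ I with label-injective p v (Inside.v∈V I) v∈ (sym e)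
  ... | refl = proj₂ (All.lookup away t∈) I

  word-around : ∀ us ts vs → order ≡ us ++ ts ++ vs →
    word ≡ map label (concatMap block us) ++ (map label (concatMap block ts) ++ map label (concatMap block vs))
  word-around us ts vs e = begin
    map label (concatMap block order)
      ≡⟨ cong (λ k → map label (concatMap block k)) e ⟩
    map label (concatMap block (us ++ ts ++ vs))
      ≡⟨ cong (map label) (trans (concatMap-++ block us (ts ++ vs)) (cong (concatMap block us ++_) (concatMap-++ block ts vs))) ⟩
    map label (concatMap block us ++ (concatMap block ts ++ concatMap block vs))
      ≡⟨ trans (map-++ label (concatMap block us) _) (cong (map label (concatMap block us) ++_) (map-++ label (concatMap block ts) _)) ⟩
    map label (concatMap block us) ++ (map label (concatMap block ts) ++ map label (concatMap block vs)) ∎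
    where open ≡-Reasoning

  parts-∈ : ∀ us ts vs → order ≡ us ++ ts ++ vs → All (_∈ V) us × All (_∈ V) vs
  parts-∈ us ts vs e = Allₚ.++⁻ˡ us all , Allₚ.++⁻ʳ ts (Allₚ.++⁻ʳ us all)
    where
    all : All (_∈ V) (us ++ ts ++ vs)
    all = subst (All (_∈ V)) e (All.tabulate order-∈)

  occ-parts : ∀ {v} us ts vs → v ∈ V → order ≡ us ++ ts ++ vs →
    All (λ t → t ≢ v × ¬ Inside v t) us → All (λ t → t ≢ v × ¬ Inside v t) vs →
    occ (label v) word ≡ occ (label v) (map label (concatMap block ts))
  occ-parts {v} us ts vs v∈ e aus avs = trans (cong (occ (label v)) (word-around us ts vs e))
    (occ-around (map label (concatMap block us)) (map label (concatMap block ts)) (map label (concatMap block vs))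
      (label-∉ v∈ (proj₁ (parts-∈ us ts vs e)) aus) (label-∉ v∈ (proj₂ (parts-∈ us ts vs e)) avs))

  label-≢ : ∀ {u v} → u ∈ V → v ∈ V → u ≢ v → label u ≢ label v
  label-≢ u∈ v∈ ne e = ne (label-injective _ _ u∈ v∈ e)

  non-corner-once : ∀ {v} → v ∈ V → ¬ Corner V v → occ (label v) word ≡ 1
  non-corner-once {v} v∈ nc with split-at order-sorted (∈-order v∈)
  ... | us , vs , e , l , r , _ = trans
        (occ-parts us (v ∷ []) vs v∈ e
          (All.map (λ lt → (λ { refl → ℕₚ.<-irrefl refl lt }) , not-inner) l)
          (All.map (λ lt → (λ { refl → ℕₚ.<-irrefl refl lt }) , not-inner) r))
        (once (block v) (block-view v∈))
    where
    not-inner : ∀ {t} → ¬ Inside v t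
    not-inner I = nc (InsideProperties.inside⇒corner I)
    once : ∀ b → Block v b → occ (label v) (map label (b ++ [])) ≡ 1
    once _ (plain _) = occ-singleton (label v)
    once _ (after _ I) = occ-pairˡ (label-≢ (Inside.v∈V I) v∈ (InsideProperties.v≢m I))
    once _ (before _ I) = occ-pairʳ (label-≢ (Inside.v∈V I) v∈ (InsideProperties.v≢m I))

  twice-with-gap-2 : ∀ {v q r} us ts vs → v ∈ V → q ∈ V → r ∈ V → q ≢ v → r ≢ v →
    order ≡ us ++ ts ++ vs → concatMap block ts ≡ v ∷ q ∷ r ∷ v ∷ [] →
    All (λ t → t ≢ v × ¬ Inside v t) us → All (λ t → t ≢ v × ¬ Inside v t) vs →
    occ (label v) word ≡ 2 × Gap2 (label v) word
  twice-with-gap-2 {v} {q} {r} us ts vs v∈ q∈ r∈ q≢v r≢v e b aus avs =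
    trans (occ-parts us ts vs v∈ e aus avs)
      (trans (cong (λ k → occ (label v) (map label k)) b)
        (occ-gap {label v} {label q} {label r} (label-≢ q∈ v∈ q≢v) (label-≢ r∈ v∈ r≢v))) ,
    (map label (concatMap block us) , label q ∷ label r ∷ [] , map label (concatMap block vs) ,
      trans (word-around us ts vs e)
        (cong (λ k → map label (concatMap block us) ++ (map label k ++ map label (concatMap block vs))) b) ,
      refl)

  -- Being inside `m` reduces the interval of `v` to one cell, which leaves no room for an interval
  -- strictly inside it.
  inner-not-outer : ∀ {v m v'} → Inside v m → ¬ Inside v' v
  inner-not-outer {v} {m} {v'} I I' = ℕₚ.<-irrefl refl (ℕₚ.<-≤-trans (Inside.lo≺ I')
    (ℕₚ.≤-trans (α≤β (Inside.v∈V I')) (ℕₚ.≤-trans (ℕₚ.<⇒≤ (Inside.hi≺ I')) (ℕₚ.≤-reflexive (cong κ (InsideProperties.hi≡lo I))))))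

  ≡true⇒≢false : ∀ {b} → b ≡ true → b ≢ false
  ≡true⇒≢false refl ()

  away : ∀ {v m t} → Inside v m → ¬ (pos t ≡ pos v) → ¬ (pos t ≡ pos m) → t ≢ v × ¬ Inside v t
  away I nv nm = (λ e → nv (cong pos e)) , (λ I' → nm (cong pos (outer-unique I' I)))

  -- The leading keys of `v`, `s`, `m` are `odd (β v)`, `even (β m)` and `odd (β m)`, the middle one
  -- because `s` starts in the last cell of `m`. No cell lies between those of `v` and `hi m`, so
  -- only vertices with equal keys could intervene; `v-unique`, `s-unique` and `m-first` exclude
  -- them.
  low-corner : ∀ {v m} → Inside v m → low m ≡ true → occ (label v) word ≡ 2 × Gap2 (label v) word
  low-corner {v} {m} I m-low
    with consecutive order-sorted (∈-order v∈V) (∈-order s∈V) (∈-order m∈V) v⊏s s⊏m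
           (λ t∈ v⊏t t⊏m → between-is-s (order-∈ t∈) (low _) refl v⊏t t⊏m)
    where
    open Inside I
    open InsideProperties I
    v-low : low v ≡ true
    v-low = trans same m-low
    s-high : low s ≡ false
    s-high = Boolₚ.¬-not (λ e → s-class (trans e (sym m-low)))
    α-s : α s ≡ β m
    α-s = cong κ lo-s
    v⊏s : v ⊏ s
    v⊏s = subst₂ (λ i j → posIn i v < posIn j s) (sym v-low) (sym s-high)
            (pos-low-high {v} {s} v∈V (subst (β v <_) (sym α-s) hi≺))
    s⊏m : s ⊏ m
    s⊏m = subst₂ (λ i j → posIn i s < posIn j m) (sym s-high) (sym m-low)
            (pos-high-low {s} {m} s∈V (ℕₚ.≤-reflexive α-s))
    between-is-s : ∀ {t} → t ∈ V → ∀ c → low t ≡ c → v ⊏ t → t ⊏ m → t ≡ s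
    between-is-s {t} t∈ false t-high v⊏t t⊏m = s-unique t∈ (λ e → ≡true⇒≢false m-low (trans (sym e) t-high))
      (subst (_< α t) (cong κ hi≡lo)
        (pos-low-high⁻ {v} {t} t∈ (subst₂ (λ i j → posIn i v < posIn j t) v-low t-high v⊏t)))
      (ℕₚ.≤⇒≯ (pos-high-low⁻ {t} {m} m∈V (subst₂ (λ i j → posIn i t < posIn j m) t-high m-low t⊏m)))
    between-is-s {t} t∈ true t-low v⊏t t⊏m
      with pos-low-low⁻ {v} {t} t∈ (subst₂ (λ i j → posIn i v < posIn j t) v-low t-low v⊏t)
         | pos-low-low⁻ {t} {m} m∈V (subst₂ (λ i j → posIn i t < posIn j m) t-low m-low t⊏m)
    ... | inj₂ (e , _) | _ with v-unique t∈ (trans t-low (sym m-low))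
                                  (trans (κ-injective (proj₁ (hi-spec t∈)) (proj₁ (hi-spec v∈V)) (sym e)) hi≡lo)
    ...   | refl = ⊥-elim (ℕₚ.<-irrefl refl v⊏t)
    between-is-s {t} t∈ true t-low v⊏t t⊏m | inj₁ lt | inj₁ lt' =
      ⊥-elim (nothing-between (proj₁ (hi-spec t∈)) (subst (_< β t) (cong κ hi≡lo) lt) lt')
    between-is-s {t} t∈ true t-low v⊏t t⊏m | inj₁ lt | inj₂ (e , τ<) =
      ⊥-elim (ℕₚ.<-asym τ< (τ-< m∈V (ℕₚ.+-mono-<-≤
        (m-first t∈ (trans t-low (sym m-low)) (κ-injective (proj₁ (hi-spec t∈)) (proj₁ (hi-spec m∈V)) e)
          (λ { refl → ℕₚ.<-irrefl refl t⊏m }))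
        (ℕₚ.≤-reflexive (sym e)))))
  ... | us , vs , e , l , r = twice-with-gap-2 us (v ∷ s ∷ m ∷ []) vs v∈V s∈V m∈V
          (λ e → s∉d (subst (_∈□ d) (sym e) v∈d)) (λ e → v≢m (sym e)) e
          (cong₂ _++_ (block-plain v∈V (inner-not-outer I))
            (cong₂ _++_ (block-plain s∈V s-not-outer) (cong (_++ []) (block-after I m-low))))
          (All.map (λ lt → away I (ℕₚ.<⇒≢ lt) (ℕₚ.<⇒≢ (ℕₚ.<-trans lt v⊏m))) l)
          (All.map (λ gt → away I (ℕₚ.>⇒≢ (ℕₚ.<-trans v⊏m gt)) (ℕₚ.>⇒≢ gt)) r)
    where
    open Inside I
    open InsideProperties I
    v⊏m : v ⊏ m
    v⊏m = inside-pos-low I m-low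

  -- Read in the reversed chain, `s` is a neighbour of `m` in `lo m`. The other vertices of the
  -- class of `m` starting in that cell end earlier than `m`, so the tie-break puts `m` last among
  -- them, next to `s`.
  high-corner : ∀ {v m} → Inside v m → low m ≡ false → occ (label v) word ≡ 2 × Gap2 (label v) word
  high-corner {v} {m} I m-high
    with consecutive order-sorted (∈-order m∈V) (∈-order s∈V) (∈-order v∈V) m⊏s s⊏v
           (λ t∈ m⊏t t⊏v → between-is-s (order-∈ t∈) (low _) refl m⊏t t⊏v)
    where
    open Inside I
    open ChainProperties.InsideProperties (reverse chain) (reverse-inside chain I)
    v-high : low v ≡ false
    v-high = trans same m-high
    s-low : low s ≡ true
    s-low = Boolₚ.¬-not (λ e → s-class (trans e (sym m-high)))
    β-s : β s ≡ α m
    β-s = cong κ lo-s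
    m⊏s : m ⊏ s
    m⊏s = subst₂ (λ i j → posIn i m < posIn j s) (sym m-high) (sym s-low)
            (pos-high-low {m} {s} m∈V (ℕₚ.≤-reflexive (sym β-s)))
    s⊏v : s ⊏ v
    s⊏v = subst₂ (λ i j → posIn i s < posIn j v) (sym s-low) (sym v-high)
            (pos-low-high {s} {v} s∈V (subst (_< α v) (sym β-s) lo≺))
    between-is-s : ∀ {t} → t ∈ V → ∀ c → low t ≡ c → m ⊏ t → t ⊏ v → t ≡ s
    between-is-s {t} t∈ true t-low m⊏t t⊏v = s-unique t∈ (λ e → ≡true⇒≢false t-low (trans e m-high))
      (subst (β t <_) (cong κ hi≡lo)
        (pos-low-high⁻ {t} {v} v∈V (subst₂ (λ i j → posIn i t < posIn j v) t-low v-high t⊏v)))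
      (ℕₚ.≤⇒≯ (pos-high-low⁻ {m} {t} t∈ (subst₂ (λ i j → posIn i m < posIn j t) m-high t-low m⊏t)))
    between-is-s {t} t∈ false t-high m⊏t t⊏v
      with pos-high-high⁻ {t} {v} v∈V (subst₂ (λ i j → posIn i t < posIn j v) t-high v-high t⊏v)
         | pos-high-high⁻ {m} {t} t∈ (subst₂ (λ i j → posIn i m < posIn j t) m-high t-high m⊏t)
    ... | inj₂ (e , _) | _ with v-unique t∈ (trans t-high (sym m-high))
                                  (trans (κ-injective (proj₁ (lo-spec t∈)) (proj₁ (lo-spec v∈V)) e) hi≡lo)
    ...   | refl = ⊥-elim (ℕₚ.<-irrefl refl t⊏v)
    between-is-s {t} t∈ false t-high m⊏t t⊏v | inj₁ lt | inj₁ lt' =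
      ⊥-elim (nothing-between (proj₁ (lo-spec t∈)) (subst (α t <_) (cong κ hi≡lo) lt) lt')
    between-is-s {t} t∈ false t-high m⊏t t⊏v | inj₁ lt | inj₂ (e , τ<) =
      ⊥-elim (ℕₚ.<-asym τ< (τ-< t∈ (ℕₚ.+-mono-≤-< (ℕₚ.≤-reflexive (sym e))
        (m-first t∈ (trans t-high (sym m-high)) (κ-injective (proj₁ (lo-spec t∈)) (proj₁ (lo-spec m∈V)) (sym e))
          (λ { refl → ℕₚ.<-irrefl refl m⊏t })))))
  ... | us , vs , e , l , r = twice-with-gap-2 us (m ∷ s ∷ v ∷ []) vs v∈V m∈V s∈V
          (λ e → v≢m (sym e)) (λ e → s∉d (subst (_∈□ d) (sym e) v∈d)) e
          (cong₂ _++_ (block-before I m-high)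
            (cong₂ _++_ (block-plain s∈V (λ I' → s-not-outer (reverse-inside chain I')))
              (cong (_++ []) (block-plain v∈V (inner-not-outer I)))))
          (All.map (λ lt → away I (ℕₚ.<⇒≢ (ℕₚ.<-trans lt m⊏v)) (ℕₚ.<⇒≢ lt)) l)
          (All.map (λ gt → away I (ℕₚ.>⇒≢ gt) (ℕₚ.>⇒≢ (ℕₚ.<-trans m⊏v gt))) r)
    where
    open Inside I
    open ChainProperties.InsideProperties (reverse chain) (reverse-inside chain I)
    m⊏v : m ⊏ v
    m⊏v = inside-pos-high I m-high

  corner-twice : ∀ {v} → v ∈ V → Corner V v → occ (label v) word ≡ 2 × Gap2 (label v) word
  corner-twice v∈ corner with corner⇒inside v∈ corner
  ... | m , I = by-class (low m) refl
    where
    by-class : ∀ c → low m ≡ c → _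
    by-class true = low-corner I
    by-class false = high-corner I

theorem24 : ∀ (V : List Point) → SquareGridGraph V → Representable12 V →
    (∃[ ℓ ] ∃[ w ] (Labeling V ℓ × Represents12 V ℓ w ×
    (∀ v → v ∈ V → Corner V v → occ (ℓ v) w ≡ 2 × Gap2 (ℓ v) w) ×
    (∀ v → v ∈ V → ¬ Corner V v → occ (ℓ v) w ≡ 1)))
    ×
    (∀ (ℓ : Point → ℕ) (w : List ℕ) → Labeling V ℓ → Good V ℓ → Represents12 V ℓ w →
    ∀ v → v ∈ V → Corner V v → occ (ℓ v) w ≢ 1)
theorem24 V sq (ℓ , w , lab , rep) =
  (label , word , labelling , represents , (λ v → corner-twice) , (λ v → non-corner-once)) ,
  (λ ℓ' w' lab' _ rep' v → Represented.corner-occurs-twice sq lab' rep')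
  where open Construction sq lab rep
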